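{- For all integers $3\le s<t$ there is a positive constant $C$ depending only on $s$ such that for every integer $n\ge 2$, $$ f_{s-1,t-1}^{(2)}\big(\lfloor \sqrt{\log n}\rfloor\big) \le f_{s,t}^{(3)}(n) \le C\log n . $$
   Context: For integers $k\le s<t$ and $n\ge 0$, $f_{s,t}^{(k)}(n)$ is defined as $$ f_{s,t}^{(k)}(n)=\min_{\mathcal{G}} \max\{ |W| : W\subseteq V(\mathcal{G}) \text{ and the induced subhypergraph } \mathcal{G}[W] \text{ contains no copy of } K_s^{(k)}\}, $$ where the minimum is over all $k$-uniform hypergraphs $\mathcal{G}$ on $n$ vertices containing no copy of $K_t^{(k)}$, and $K_r^{(k)}$ denotes the complete $k$-uniform hypergraph on $r$ vertices (so for $k=2$, $K_r^{(2)}=K_r$ and $f^{(2)}_{s,t}$ concerns graphs). All logarithms are natural logarithms. -}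

module Defs where

open import Data.Bool using (Bool; true; false; T; _∧_)
open import Data.Bool.Properties using (T?; T-∧)
open import Data.Empty using (⊥-elim)
open import Data.Fin.Subset as Subset using (Subset; inside; outside; _⊆_; ⊤; ∣_∣)
open import Data.Fin.Subset.Properties using (_⊆?_; anySubset?; ∣⊤∣≡n; ∣p∣≤n; ⊥⊆; ∣⊥∣≡0; out⊆; in⊆in; p⊆q⇒∣p∣≤∣q∣)
import Data.Integer as ℤ
import Data.Integer.Properties as ℤ
open import Data.List using (List; []; _∷_; _++_; map; filter; cartesianProductWith)
open import Data.List.Extrema.Nat using (min; max; argmin-sel; argmax-sel; min≤xs; xs≤max)
open import Data.List.Membership.Propositional using (_∈_)
open import Data.List.Membership.Propositional.Properties using (∈-map⁺; ∈-map⁻; ∈-++⁺ˡ; ∈-++⁺ʳ; ∈-filter⁺; ∈-filter⁻; ∈-cartesianProductWith⁺)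
open import Data.List.Relation.Unary.All as All using ()
open import Data.List.Relation.Unary.Any using (here; there)
open import Data.Nat as ℕ using (ℕ; zero; suc; z≤n; s≤s)
import Data.Nat.Properties as ℕ
open import Data.Product using (∃; ∃-syntax; _×_; _,_; proj₁; proj₂)
open import Data.Rational as ℚ using (ℚ; 0ℚ; 1ℚ; _/_)
import Data.Rational.Properties as ℚ
import Data.Rational.Unnormalised as ℚᵘ
import Data.Rational.Unnormalised.Properties as ℚᵘ
open import Data.Sum using (inj₁; inj₂)
open import Data.Vec using ([]; _∷_)
open import Function using (_∘_; Equivalence)
open import Relation.Binary.PropositionalEquality using (_≡_; refl; sym; trans; cong; subst)
open import Relation.Nullary using (¬_; Dec; ¬?; contradiction)
open import Relation.Nullary.Decidable using (map′; decidable-stable; _×-dec_)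

-- The vertex set is Fin n.
record Hypergraph (k n : ℕ) : Set where
  field
    edge?   : Subset n → Bool
    uniform : ∀ e → T (edge? e) → ∣ e ∣ ≡ k

  Edge : Subset n → Set
  Edge e = T (edge? e)

open Hypergraph public

private variable
  k n : ℕ

Complete : Hypergraph k n → Subset n → Set
Complete {k} G S = ∀ e → e ⊆ S → ∣ e ∣ ≡ k → Edge G e

-- The induced subhypergraph G[W] contains a copy of the complete k-uniform
-- hypergraph K_r.  The edges of G[W] are the edges of G inside W, so for S ⊆ W
-- completeness in G[W] is completeness in G.
_[_]Contains-K_ : Hypergraph k n → Subset n → ℕ → Set
G [ W ]Contains-K r = ∃[ S ] (S ⊆ W × ∣ S ∣ ≡ r × Complete G S)

_Contains-K_ : Hypergraph k n → ℕ → Set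
G Contains-K r = G [ ⊤ ]Contains-K r

complete? : (G : Hypergraph k n) (S : Subset n) → Dec (Complete G S)
complete? {k} {n} G S = map′ complete (λ c (e , e⊆S , ∣e∣≡k , ¬edge) → ¬edge (c e e⊆S ∣e∣≡k))
  (¬? (anySubset? λ e → (e ⊆? S) ×-dec ((∣ e ∣ ℕ.≟ k) ×-dec ¬? (T? (edge? G e)))))
  where
  Missing : Subset n → Set
  Missing e = e ⊆ S × ∣ e ∣ ≡ k × ¬ Edge G e

  complete : ¬ ∃ Missing → Complete G S
  complete ¬missing e e⊆S ∣e∣≡k =
    decidable-stable (T? _) λ ¬edge → ¬missing (e , e⊆S , ∣e∣≡k , ¬edge)

_[_]contains-K?_ : (G : Hypergraph k n) (W : Subset n) (r : ℕ) →
                   Dec (G [ W ]Contains-K r)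
G [ W ]contains-K? r =
  anySubset? λ S → (S ⊆? W) ×-dec (∣ S ∣ ℕ.≟ r) ×-dec complete? G S

subsets : ∀ n → List (Subset n)
subsets zero    = [] ∷ []
subsets (suc n) = map (outside ∷_) (subsets n) ++ map (inside ∷_) (subsets n)

glue : (Subset n → Bool) → (Subset n → Bool) → Subset (suc n) → Bool
glue g h (outside ∷ e) = g e
glue g h (inside  ∷ e) = h e

-- All families of subsets of Fin n, up to pointwise equality.
families : ∀ n → List (Subset n → Bool)
families zero    = (λ _ → false) ∷ (λ _ → true) ∷ []
families (suc n) = cartesianProductWith glue (families n) (families n)

restrict : ∀ k → (Subset n → Bool) → Hypergraph k n
restrict k f .edge? e = (∣ e ∣ ℕ.≡ᵇ k) ∧ f e
restrict k f .uniform e h = ℕ.≡ᵇ⇒≡ _ _ (proj₁ (Equivalence.to T-∧ h))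

-- All k-uniform hypergraphs on Fin n, up to equality of edge sets.
hypergraphs : ∀ k n → List (Hypergraph k n)
hypergraphs k n = map (restrict k) (families n)

-- max { |W| : G[W] contains no K_s }.  The default 0 is harmless: for
-- s ≥ 1 the empty set W is admissible.
α : ℕ → Hypergraph k n → ℕ
α {n = n} s G =
  max 0 (map ∣_∣ (filter (λ W → ¬? (G [ W ]contains-K? s)) (subsets n)))

-- min { α s G : G contains no K_t }.  The default n is harmless: for
-- k ≤ s < t the empty hypergraph is admissible and has α equal to n.
f : (k s t n : ℕ) → ℕ
f k s t n =
  min n (map (α s) (filter (λ G → ¬? (G [ ⊤ ]contains-K? t)) (hypergraphs k n)))

private
  ∈-subsets : (W : Subset n) → W ∈ subsets n
  ∈-subsets []            = here refl
  ∈-subsets (outside ∷ W) = ∈-++⁺ˡ (∈-map⁺ _ (∈-subsets W))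
  ∈-subsets (inside  ∷ W) = ∈-++⁺ʳ _ (∈-map⁺ _ (∈-subsets W))

  ∈-families : (f : Subset n → Bool) → ∃[ g ] (g ∈ families n × ∀ e → g e ≡ f e)
  ∈-families {zero} f with f [] in eq
  ... | false = _ , here refl , λ { [] → sym eq }
  ... | true  = _ , there (here refl) , λ { [] → sym eq }
  ∈-families {suc n} f
    with g , g∈ , g≗ ← ∈-families (f ∘ (outside ∷_))
       | h , h∈ , h≗ ← ∈-families (f ∘ (inside ∷_))
    = _ , ∈-cartesianProductWith⁺ glue g∈ h∈
        , λ { (outside ∷ e) → g≗ e ; (inside ∷ e) → h≗ e }

  restrict-≗ : (G : Hypergraph k n) {f : Subset n → Bool} →
               (∀ e → f e ≡ edge? G e) → ∀ e → edge? (restrict k f) e ≡ edge? G e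
  restrict-≗ {k = k} G f≗ e with ∣ e ∣ ℕ.≡ᵇ k in size | edge? G e in edge
  ... | true  | _     = trans (f≗ e) edge
  ... | false | false = refl
  ... | false | true  =
    ⊥-elim (subst T size (ℕ.≡⇒≡ᵇ _ _ (uniform G e (subst T (sym edge) _))))

  contains-≗ : {G H : Hypergraph k n} → (∀ e → edge? G e ≡ edge? H e) →
               ∀ {W r} → G [ W ]Contains-K r → H [ W ]Contains-K r
  contains-≗ eq (S , S⊆W , ∣S∣≡r , c) =
    S , S⊆W , ∣S∣≡r , λ e e⊆S ∣e∣≡k → subst T (eq e) (c e e⊆S ∣e∣≡k)

  subset-of-size : ∀ k (S : Subset n) → k ℕ.≤ ∣ S ∣ → ∃[ e ] (e ⊆ S × ∣ e ∣ ≡ k)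
  subset-of-size {n} zero S _ = Subset.⊥ , ⊥⊆ , ∣⊥∣≡0 n
  subset-of-size (suc k) (outside ∷ S) le
    with e , e⊆S , eq ← subset-of-size (suc k) S le = outside ∷ e , out⊆ e⊆S , eq
  subset-of-size (suc k) (inside ∷ S) (s≤s le)
    with e , e⊆S , eq ← subset-of-size k S le = inside ∷ e , in⊆in e⊆S , cong suc eq

α-upper : ∀ s (G : Hypergraph k n) W → ¬ (G [ W ]Contains-K s) → ∣ W ∣ ℕ.≤ α s G
α-upper s G W free =
  All.lookup (xs≤max 0 _) (∈-map⁺ ∣_∣ (∈-filter⁺ _ (∈-subsets W) free))

α-attained : ∀ {s} → 1 ℕ.≤ s → (G : Hypergraph k n) →
             ∃[ W ] (¬ (G [ W ]Contains-K s) × ∣ W ∣ ≡ α s G)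
α-attained {n = n} {s} 1≤s G
  with argmax-sel (λ x → x) 0
         (map ∣_∣ (filter (λ W → ¬? (G [ W ]contains-K? s)) (subsets n)))
... | inj₁ eq = Subset.⊥
              , (λ { (S , S⊆⊥ , refl , _) → contradiction
                     (ℕ.≤-trans 1≤s (subst (∣ S ∣ ℕ.≤_) (∣⊥∣≡0 n) (p⊆q⇒∣p∣≤∣q∣ {p = S} {q = Subset.⊥} S⊆⊥)))
                     λ () })
              , trans (∣⊥∣≡0 n) (sym eq)
... | inj₂ m∈ with W , W∈ , eq ← ∈-map⁻ ∣_∣ m∈
    = W , proj₂ (∈-filter⁻ _ {xs = subsets n} W∈) , sym eq

private
  α-≗ : ∀ {s} → 1 ℕ.≤ s → {G H : Hypergraph k n} →
        (∀ e → edge? G e ≡ edge? H e) → α s G ℕ.≤ α s H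
  α-≗ {s = s} 1≤s {G} {H} eq with W , free , ∣W∣≡α ← α-attained 1≤s G =
    subst (ℕ._≤ α s H) ∣W∣≡α (α-upper s H W (free ∘ contains-≗ {G = H} {G} (sym ∘ eq)))

f-lower : ∀ {s t} → 1 ℕ.≤ s → (G : Hypergraph k n) → ¬ (G Contains-K t) →
          f k s t n ℕ.≤ α s G
f-lower {k} 1≤s G free with g , g∈ , g≗ ← ∈-families (edge? G) =
  ℕ.≤-trans
    (All.lookup (min≤xs _ _)
      (∈-map⁺ _ (∈-filter⁺ _ (∈-map⁺ (restrict k) g∈)
        (free ∘ contains-≗ {G = restrict k g} {G} (restrict-≗ G g≗)))))
    (α-≗ 1≤s {restrict k g} {G} (restrict-≗ G g≗))

f-attained : ∀ {s t} → k ℕ.≤ s → s ℕ.< t → ∀ n →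
             ∃[ G ] (¬ (_Contains-K_ {k} {n} G t) × α s G ≡ f k s t n)
f-attained {k} {s} {t} k≤s s<t n
  with argmin-sel (λ x → x) n
         (map (α s) (filter (λ G → ¬? (G [ ⊤ ]contains-K? t)) (hypergraphs k n)))
... | inj₂ m∈ with G , G∈ , eq ← ∈-map⁻ (α s) m∈
    = G , proj₂ (∈-filter⁻ _ {xs = hypergraphs k n} G∈) , sym eq
... | inj₁ eq = empty , free (ℕ.≤-trans k≤s (ℕ.<⇒≤ s<t)) , trans α≡n (sym eq)
  where
  empty : Hypergraph k n
  empty .edge? _ = false
  empty .uniform _ ()

  free : ∀ {W r} → k ℕ.≤ r → ¬ (empty [ W ]Contains-K r)
  free k≤r (S , _ , refl , c) with e , e⊆S , ∣e∣≡k ← subset-of-size k S k≤r =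
    c e e⊆S ∣e∣≡k

  α≤n : α s empty ℕ.≤ n
  α≤n with argmax-sel (λ x → x) 0
             (map ∣_∣ (filter (λ W → ¬? (empty [ W ]contains-K? s)) (subsets n)))
  ... | inj₁ eq′ = subst (ℕ._≤ n) (sym eq′) z≤n
  ... | inj₂ m∈ with W , _ , eq′ ← ∈-map⁻ ∣_∣ m∈ = subst (ℕ._≤ n) (sym eq′) (∣p∣≤n W)

  α≡n : α s empty ≡ n
  α≡n = ℕ.≤-antisym α≤n
    (subst (ℕ._≤ α s empty) (∣⊤∣≡n n) (α-upper s empty ⊤ (free k≤s)))

fromℕ : ℕ → ℚ
fromℕ m = ℤ.+ m / 1

-- x ^ i / i !
expTerm : ℚ → ℕ → ℚ
expTerm x zero    = 1ℚ
expTerm x (suc i) = expTerm x i ℚ.* x ℚ.* (ℤ.+ 1 / suc i)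

-- Σ_{i ≤ N} x ^ i / i !
expSum : ℚ → ℕ → ℚ
expSum x zero    = expTerm x zero
expSum x (suc N) = expSum x N ℚ.+ expTerm x (suc N)

-- The real number log n is given by its upper cut: log n < x iff n < exp x.
-- For x ≥ 0, exp x is the supremum of the increasing sequence expSum x.
-- No x < 0 belongs to the cut since log n ≥ 0; hence this
-- describes log n only for n ≥ 1.
log_<_ : ℕ → ℚ → Set
log n < x = 0ℚ ℚ.≤ x × ∃[ N ] fromℕ n ℚ.< expSum x N

-- y ≤ C · log n, for C > 0: log n is the infimum of its upper cut.
_≤_·log_ : ℚ → ℚ → ℕ → Set
y ≤ C ·log n = ∀ x → log n < x → y ℚ.≤ C ℚ.* x

-- m = ⌊√(log n)⌋, that is, m² ≤ log n < (m + 1)².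
-- It is a relation because computing the floor constructively would
-- require deciding exp (m ^ 2) ≤ n; see ⌊√log⌋-exists below.
_≡⌊√log_⌋ : ℕ → ℕ → Set
m ≡⌊√log n ⌋ = (fromℕ (m ℕ.^ 2) ≤ 1ℚ ·log n) × (log n < fromℕ (suc m ℕ.^ 2))

private
  module _ {x y : ℚ} (0≤x : 0ℚ ℚ.≤ x) (x≤y : x ℚ.≤ y) where
    private instance
      _ = ℚ.nonNegative 0≤x
      _ = ℚ.nonNegative (ℚ.≤-trans 0≤x x≤y)

    expTerm-nonNeg : ∀ i → ℚ.NonNegative (expTerm y i)
    expTerm-nonNeg zero    = _
    expTerm-nonNeg (suc i) =
      ℚ.nonNeg*nonNeg⇒nonNeg (expTerm y i ℚ.* y)
        {{ℚ.nonNeg*nonNeg⇒nonNeg (expTerm y i) {{expTerm-nonNeg i}} y}}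
        (ℤ.+ 1 / suc i) {{ℚ.normalize-nonNeg 1 (suc i)}}

    expTerm-mono : ∀ i → expTerm x i ℚ.≤ expTerm y i
    expTerm-mono zero    = ℚ.≤-refl
    expTerm-mono (suc i) =
      ℚ.*-monoʳ-≤-nonNeg (ℤ.+ 1 / suc i) {{ℚ.normalize-nonNeg 1 (suc i)}}
        (ℚ.≤-trans
          (ℚ.*-monoʳ-≤-nonNeg x (expTerm-mono i))
          (ℚ.*-monoˡ-≤-nonNeg (expTerm y i) {{expTerm-nonNeg i}} x≤y))

    expSum-mono : ∀ N → expSum x N ℚ.≤ expSum y N
    expSum-mono zero    = ℚ.≤-refl
    expSum-mono (suc N) = ℚ.+-mono-≤ (expSum-mono N) (expTerm-mono (suc N))

  log<-mono : ∀ {n x y} → log n < x → x ℚ.≤ y → log n < y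
  log<-mono (0≤x , N , n<S) x≤y =
    ℚ.≤-trans 0≤x x≤y , N , ℚ.<-≤-trans n<S (expSum-mono 0≤x x≤y N)

  fromℕ-mono : ∀ {a b} → a ℕ.≤ b → fromℕ a ℚ.≤ fromℕ b
  fromℕ-mono {a} {b} a≤b = ℚ.toℚᵘ-cancel-≤
    (ℚᵘ.≤-respˡ-≃ (ℚᵘ.≃-sym (ℚ.toℚᵘ-fromℚᵘ (ℚᵘ.mkℚᵘ (ℤ.+ a) 0)))
      (ℚᵘ.≤-respʳ-≃ (ℚᵘ.≃-sym (ℚ.toℚᵘ-fromℚᵘ (ℚᵘ.mkℚᵘ (ℤ.+ b) 0)))
        (ℚᵘ.*≤* (ℤ.*-monoʳ-≤-nonNeg (ℤ.+ 1) (ℤ.+≤+ a≤b)))))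

  log<[1+n]² : ∀ n → log n < fromℕ (suc n ℕ.^ 2)
  log<[1+n]² n = fromℕ-mono {0} {suc n ℕ.^ 2} z≤n , 1 , n<1+y
    where
    y = fromℕ (suc n ℕ.^ 2)

    n≤y : fromℕ n ℚ.≤ y
    n≤y = fromℕ-mono (ℕ.≤-trans (ℕ.n≤1+n n) (ℕ.m≤m*n (suc n) (suc n ℕ.^ 1)))

    n<1+y : fromℕ n ℚ.< 1ℚ ℚ.+ 1ℚ ℚ.* y ℚ.* 1ℚ
    n<1+y = subst (λ z → fromℕ n ℚ.< 1ℚ ℚ.+ z)
      (sym (trans (ℚ.*-identityʳ _) (ℚ.*-identityˡ y)))
      (subst (ℚ._< 1ℚ ℚ.+ y) (ℚ.+-identityˡ (fromℕ n))
        (ℚ.+-mono-<-≤ (ℚ.positive⁻¹ 1ℚ) n≤y))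

⌊√log⌋-exists : ∀ n → ¬ ¬ (∃[ m ] m ≡⌊√log n ⌋)
⌊√log⌋-exists n none = none (n , lower n , log<[1+n]² n)
  where
  lower : ∀ m → fromℕ (m ℕ.^ 2) ≤ 1ℚ ·log n
  lower zero x (0≤x , _) = subst (0ℚ ℚ.≤_) (sym (ℚ.*-identityˡ x)) 0≤x
  lower (suc m) x log<x with ℚ.≤-total (fromℕ (suc m ℕ.^ 2)) x
  ... | inj₁ le = subst (fromℕ (suc m ℕ.^ 2) ℚ.≤_) (sym (ℚ.*-identityˡ x)) le
  ... | inj₂ ge = ⊥-elim (none (m , lower m , log<-mono {n} log<x ge))

-- Upper bound.  Colour the pairs of vertices at random with s − 1 colours and let
-- i < j < k be an edge iff χ(i,j) ≠ χ(i,k).  By pigeonhole on the least vertex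
-- there is no clique of size s + 1.  A set of C log n vertices contains ≫ (log n)²
-- s-sets no two of which share a pair (lines in a grid), each of which is a clique
-- with probability bounded below, independently of the others; so the union bound
-- over all sets applies.
--
-- Lower bound.  As n ≥ exp(m²) ≥ 2^(m²), a greedy argument finds m + 1 vertices
-- for which the status of a triple depends only on its two earliest members.  The
-- link of the last vertex is then a graph without K_{t-1}, and its K_{s-1}-free
-- sets are K_s-free in G.
module Submission where

open import Defs
import Data.Integer as ℤ
import Data.Integer.Properties as ℤ
import Data.Nat.Properties as ℕ
import Data.Rational.Unnormalised as ℚᵘ
import Data.Rational.Unnormalised.Properties as ℚᵘ

-- Why lines of a grid: a union bound over the N-sets of vertices costs up to n^N, so the number of
-- independent events must exceed a multiple of N log n. Vertex-disjoint s-sets would supply only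
-- N/s of them. Lines supply about N^2/s^4, which is enough as soon as N is a large multiple of log
-- n. Each line asks for one fixed colour pattern instead of an arbitrary clique, so its event is a
-- product over pairs and has probability exactly q^(-D), where q = s - 1. Probabilities are cleared
-- of denominators, and the colouring is found pair by pair by averaging, so only natural numbers
-- occur. The colouring excludes K_{s+1} and with it every K_t for t > s; hence C does not depend on
-- t. In the greedy selection the (i+1)-st vertex costs a factor 2^i, for the i pairs it forms with
-- earlier vertices. The product of these costs is what m^2 in the exponent pays for.

module ExpBounds where
  open import Data.Nat as ℕ using (ℕ; zero; suc)
  open import Data.Product using (_,_)
  open import Data.Rational using (ℚ; 0ℚ; 1ℚ; ½; _/_; _+_; _*_; -_; _-_; _≤_; _<_; NonNegative; nonNegative; toℚᵘ; _≤?_)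
  open import Data.Rational.Properties
  open import Data.Rational.Solver using (module +-*-Solver)
  open import Data.Sum using (inj₁; inj₂)
  open import Data.Unit using (tt)
  open import Relation.Binary.PropositionalEquality using (_≡_; refl; sym; trans; cong; cong₂; subst; subst₂; module ≡-Reasoning)
  open import Relation.Nullary using (contradiction)
  open import Relation.Nullary.Decidable using (toWitness)
  open +-*-Solver

  -- Powers of 2 against the partial sums of the exponential series.

  toℚᵘ-fromℕ : ∀ m → toℚᵘ (fromℕ m) ℚᵘ.≃ ℚᵘ.mkℚᵘ (ℤ.+ m) 0
  toℚᵘ-fromℕ m = toℚᵘ-fromℚᵘ (ℚᵘ.mkℚᵘ (ℤ.+ m) 0)

  fromℕ-+ : ∀ a b → fromℕ (a ℕ.+ b) ≡ fromℕ a + fromℕ b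
  fromℕ-+ a b = toℚᵘ-injective (begin
    toℚᵘ (fromℕ (a ℕ.+ b))                          ≈⟨ toℚᵘ-fromℕ (a ℕ.+ b) ⟩
    ℚᵘ.mkℚᵘ (ℤ.+ (a ℕ.+ b)) 0                       ≈⟨ ℚᵘ.*≡* (cong (ℤ._* ℤ.+ 1)
      (sym (cong₂ ℤ._+_ (ℤ.*-identityʳ (ℤ.+ a)) (ℤ.*-identityʳ (ℤ.+ b))))) ⟩
    ℚᵘ.mkℚᵘ (ℤ.+ a) 0 ℚᵘ.+ ℚᵘ.mkℚᵘ (ℤ.+ b) 0        ≈⟨ ℚᵘ.+-cong (toℚᵘ-fromℕ a) (toℚᵘ-fromℕ b) ⟨
    toℚᵘ (fromℕ a) ℚᵘ.+ toℚᵘ (fromℕ b)              ≈⟨ toℚᵘ-homo-+ (fromℕ a) (fromℕ b) ⟨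
    toℚᵘ (fromℕ a + fromℕ b)                        ∎)
    where open ℚᵘ.≃-Reasoning

  fromℕ-* : ∀ a b → fromℕ (a ℕ.* b) ≡ fromℕ a * fromℕ b
  fromℕ-* zero    b = sym (*-zeroˡ (fromℕ b))
  fromℕ-* (suc a) b = begin
    fromℕ (b ℕ.+ a ℕ.* b)             ≡⟨ fromℕ-+ b (a ℕ.* b) ⟩
    fromℕ b + fromℕ (a ℕ.* b)         ≡⟨ cong₂ _+_ (sym (*-identityˡ (fromℕ b))) (fromℕ-* a b) ⟩
    1ℚ * fromℕ b + fromℕ a * fromℕ b  ≡⟨ *-distribʳ-+ (fromℕ b) 1ℚ (fromℕ a) ⟨
    (1ℚ + fromℕ a) * fromℕ b          ≡⟨ cong (_* fromℕ b) (fromℕ-+ 1 a) ⟨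
    fromℕ (suc a) * fromℕ b           ∎
    where open ≡-Reasoning

  fromℕ-nonNeg : ∀ m → NonNegative (fromℕ m)
  fromℕ-nonNeg m = normalize-nonNeg m 1

  fromℕ-mono-≤ : ∀ {a b} → a ℕ.≤ b → fromℕ a ≤ fromℕ b
  fromℕ-mono-≤ {a} a≤b with d , refl ← ℕ.m≤n⇒∃[o]m+o≡n a≤b = begin
    fromℕ a            ≡⟨ +-identityʳ (fromℕ a) ⟨
    fromℕ a + 0ℚ       ≤⟨ +-monoʳ-≤ (fromℕ a) (nonNegative⁻¹ (fromℕ d) {{fromℕ-nonNeg d}}) ⟩
    fromℕ a + fromℕ d  ≡⟨ fromℕ-+ a d ⟨
    fromℕ (a ℕ.+ d)    ∎
    where open ≤-Reasoning

  recip : ℕ → ℚ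
  recip i = ℤ.+ 1 / suc i

  recip-nonNeg : ∀ i → NonNegative (recip i)
  recip-nonNeg i = normalize-nonNeg 1 (suc i)

  fromℕ*recip : ∀ i → fromℕ (suc i) * recip i ≡ 1ℚ
  fromℕ*recip i = toℚᵘ-injective (begin
    toℚᵘ (fromℕ (suc i) * recip i)                    ≈⟨ toℚᵘ-homo-* (fromℕ (suc i)) (recip i) ⟩
    toℚᵘ (fromℕ (suc i)) ℚᵘ.* toℚᵘ (recip i)          ≈⟨ ℚᵘ.*-cong (toℚᵘ-fromℕ (suc i))
                                                           (toℚᵘ-fromℚᵘ (ℚᵘ.mkℚᵘ (ℤ.+ 1) i)) ⟩
    ℚᵘ.mkℚᵘ (ℤ.+ suc i) 0 ℚᵘ.* ℚᵘ.mkℚᵘ (ℤ.+ 1) i      ≈⟨ ℚᵘ.*≡* (cong ℤ.+_ (trans (ℕ.*-identityʳ _)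
       (trans (ℕ.*-identityʳ (suc i))
       (sym (trans (ℕ.*-identityˡ _) (ℕ.*-identityˡ (suc i))))))) ⟩
    toℚᵘ 1ℚ                                           ∎)
    where open ℚᵘ.≃-Reasoning

  expTerm-nonNeg : ∀ {x} → NonNegative x → ∀ i → NonNegative (expTerm x i)
  expTerm-nonNeg         x≥0 zero    = _
  expTerm-nonNeg {x} x≥0 (suc i) =
    nonNeg*nonNeg⇒nonNeg (expTerm x i * x)
      {{nonNeg*nonNeg⇒nonNeg (expTerm x i) {{expTerm-nonNeg x≥0 i}} x {{x≥0}}}}
      (recip i) {{recip-nonNeg i}}

  expTerm-suc : ∀ x i → expTerm x (suc i) * fromℕ (suc i) ≡ expTerm x i * x
  expTerm-suc x i = begin
    expTerm x i * x * recip i * fromℕ (suc i)    ≡⟨ *-assoc (expTerm x i * x) _ _ ⟩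
    expTerm x i * x * (recip i * fromℕ (suc i))  ≡⟨ cong (expTerm x i * x *_) (trans (*-comm (recip i) _) (fromℕ*recip i)) ⟩
    expTerm x i * x * 1ℚ                         ≡⟨ *-identityʳ _ ⟩
    expTerm x i * x                              ∎
    where open ≡-Reasoning

  -- The multiple by `i + 1` comes from `expTerm-suc`, the extra `t` from the increment `h`;
  -- division by `i + 2` leaves exactly the derivative term.
  absorb : ∀ t i → (t * fromℕ (suc i) + t) * recip (suc i) ≡ t
  absorb t i = begin
    (t * fromℕ (suc i) + t) * recip (suc i)        ≡⟨ solve 3 (λ t c r → (t :* c :+ t) :* r := t :* ((con 1ℚ :+ c) :* r))
                                                            refl t (fromℕ (suc i)) (recip (suc i)) ⟩
    t * ((1ℚ + fromℕ (suc i)) * recip (suc i))     ≡⟨ cong (λ c → t * (c * recip (suc i))) (fromℕ-+ 1 (suc i)) ⟨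
    t * (fromℕ (suc (suc i)) * recip (suc i))      ≡⟨ cong (t *_) (fromℕ*recip (suc i)) ⟩
    t * 1ℚ                                         ≡⟨ *-identityʳ t ⟩
    t                                              ∎
    where open ≡-Reasoning

  p≤p+q : ∀ p q → NonNegative q → p ≤ p + q
  p≤p+q p q q≥0 = subst (_≤ p + q) (+-identityʳ p) (+-monoʳ-≤ p (nonNegative⁻¹ q {{q≥0}}))

  expSum-suc-≤ : ∀ {x} → NonNegative x → ∀ N → expSum x N ≤ expSum x (suc N)
  expSum-suc-≤ {x} x≥0 N = p≤p+q _ _ (expTerm-nonNeg x≥0 (suc N))

  -- The derivative of x^(i+1)/(i+1)! is x^i/i!, so the increment over a step `h` lies between `h`
  -- times that term at `x` and at `y`. Arguing term by term avoids limits; summation transfers the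
  -- bounds to `expSum`.
  module MeanValue (x h : ℚ) {{x≥0 : NonNegative x}} {{h≥0 : NonNegative h}} where
    y : ℚ
    y = x + h

    instance
      y≥0 : NonNegative y
      y≥0 = nonNeg+nonNeg⇒nonNeg x h

    expTerm-above : ∀ i → expTerm y (suc i) ≤ expTerm x (suc i) + h * expTerm y i
    expTerm-above zero = ≤-reflexive (solve 2
      (λ x h → con 1ℚ :* (x :+ h) :* con 1ℚ := con 1ℚ :* x :* con 1ℚ :+ h :* con 1ℚ) refl x h)
    expTerm-above (suc i) = begin
      Ty * (x + h) * r
        ≡⟨ solve 4 (λ T x h r → T :* (x :+ h) :* r := (T :* x :+ h :* T) :* r) refl Ty x h r ⟩
      (Ty * x + h * Ty) * r
        ≤⟨ *-monoʳ-≤-nonNeg r (+-monoˡ-≤ (h * Ty) (*-monoʳ-≤-nonNeg x (expTerm-above i))) ⟩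
      ((Tx + h * Ty′) * x + h * Ty) * r
        ≡⟨ solve 6 (λ Tx Ty′ x h Ty r → ((Tx :+ h :* Ty′) :* x :+ h :* Ty) :* r :=
                    Tx :* x :* r :+ h :* ((Ty′ :* x :+ Ty) :* r)) refl Tx Ty′ x h Ty r ⟩
      Tx * x * r + h * ((Ty′ * x + Ty) * r)
        ≤⟨ +-monoʳ-≤ (Tx * x * r) (*-monoˡ-≤-nonNeg h (*-monoʳ-≤-nonNeg r (+-monoˡ-≤ Ty
             (*-monoˡ-≤-nonNeg Ty′ {{expTerm-nonNeg y≥0 i}} (p≤p+q x h h≥0))))) ⟩
      Tx * x * r + h * ((Ty′ * y + Ty) * r)
        ≡⟨ cong (λ z → Tx * x * r + h * ((z + Ty) * r)) (expTerm-suc y i) ⟨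
      Tx * x * r + h * ((Ty * fromℕ (suc i) + Ty) * r)
        ≡⟨ cong (λ z → Tx * x * r + h * z) (absorb Ty i) ⟩
      Tx * x * r + h * Ty
        ∎
      where
      open ≤-Reasoning
      r = recip (suc i)
      Tx = expTerm x (suc i)
      Ty = expTerm y (suc i)
      Ty′ = expTerm y i
      instance
        _ = recip-nonNeg (suc i)

    expTerm-below : ∀ i → expTerm x (suc i) + h * expTerm x i ≤ expTerm y (suc i)
    expTerm-below zero = ≤-reflexive (solve 2
      (λ x h → con 1ℚ :* x :* con 1ℚ :+ h :* con 1ℚ := con 1ℚ :* (x :+ h) :* con 1ℚ) refl x h)
    expTerm-below (suc i) = begin
      Tx * x * r + h * Tx
        ≡⟨ cong (λ z → Tx * x * r + h * z) (absorb Tx i) ⟨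
      Tx * x * r + h * ((Tx * fromℕ (suc i) + Tx) * r)
        ≡⟨ cong (λ z → Tx * x * r + h * ((z + Tx) * r)) (expTerm-suc x i) ⟩
      Tx * x * r + h * ((Tx′ * x + Tx) * r)
        -- The missing second-order term in `h` completes the product `(Tx + h * Tx′) * (x + h)`.
        ≤⟨ p≤p+q _ (h * Tx′ * h * r) (nonNeg*nonNeg⇒nonNeg (h * Tx′ * h)
             {{nonNeg*nonNeg⇒nonNeg (h * Tx′) {{nonNeg*nonNeg⇒nonNeg h Tx′}} h}} r) ⟩
      Tx * x * r + h * ((Tx′ * x + Tx) * r) + h * Tx′ * h * r
        ≡⟨ solve 5 (λ Tx Tx′ x h r → Tx :* x :* r :+ h :* ((Tx′ :* x :+ Tx) :* r) :+ h :* Tx′ :* h :* r :=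
                    (Tx :+ h :* Tx′) :* (x :+ h) :* r) refl Tx Tx′ x h r ⟩
      (Tx + h * Tx′) * y * r
        ≤⟨ *-monoʳ-≤-nonNeg r (*-monoʳ-≤-nonNeg y (expTerm-below i)) ⟩
      expTerm y (suc i) * y * r
        ∎
      where
      open ≤-Reasoning
      r = recip (suc i)
      Tx = expTerm x (suc i)
      Tx′ = expTerm x i
      instance
        _ = recip-nonNeg (suc i)
        _ = expTerm-nonNeg x≥0 i

    regroup : ∀ a b c d → a + h * b + (c + h * d) ≡ a + c + h * (b + d)
    regroup a b c d = solve 5 (λ a b c d h → a :+ h :* b :+ (c :+ h :* d) := a :+ c :+ h :* (b :+ d)) refl a b c d h

    expSum-above : ∀ N → expSum y (suc N) ≤ expSum x (suc N) + h * expSum y N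
    expSum-above zero = ≤-trans (+-monoʳ-≤ 1ℚ (expTerm-above zero))
      (≤-reflexive (sym (+-assoc 1ℚ (expTerm x 1) (h * 1ℚ))))
    expSum-above (suc N) = ≤-trans (+-mono-≤ (expSum-above N) (expTerm-above (suc N)))
      (≤-reflexive (regroup (expSum x (suc N)) (expSum y N) (expTerm x (suc (suc N))) (expTerm y (suc N))))

    expSum-below : ∀ N → expSum x (suc N) + h * expSum x N ≤ expSum y (suc N)
    expSum-below zero = ≤-trans (≤-reflexive (+-assoc 1ℚ (expTerm x 1) (h * 1ℚ)))
      (+-monoʳ-≤ 1ℚ (expTerm-below zero))
    expSum-below (suc N) = ≤-trans
      (≤-reflexive (sym (regroup (expSum x (suc N)) (expSum x N) (expTerm x (suc (suc N))) (expTerm x (suc N)))))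
      (+-mono-≤ (expSum-below N) (expTerm-below (suc N)))

  expSum-nonNeg : ∀ {x} → NonNegative x → ∀ N → NonNegative (expSum x N)
  expSum-nonNeg x≥0 zero    = _
  expSum-nonNeg {x} x≥0 (suc N) =
    nonNeg+nonNeg⇒nonNeg (expSum x N) {{expSum-nonNeg x≥0 N}} (expTerm x (suc N)) {{expTerm-nonNeg x≥0 (suc N)}}

  2q≡q+q : ∀ q → fromℕ 2 * q ≡ q + q
  2q≡q+q q = solve 1 (λ q → con (fromℕ 2) :* q := q :+ q) refl q

  fromℕ-2^suc : ∀ k → fromℕ (2 ℕ.^ suc k) ≡ fromℕ (2 ℕ.^ k) + fromℕ (2 ℕ.^ k)
  fromℕ-2^suc k = trans (fromℕ-* 2 (2 ℕ.^ k)) (2q≡q+q (fromℕ (2 ℕ.^ k)))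

  -- exp (x + h) ≤ exp x + h · exp (x + h), so exp at most doubles over a step of ½.
  expSum-half-step : ∀ x h → NonNegative x → NonNegative h → h ≤ ½ → ∀ N →
                     expSum (x + h) N ≤ expSum x N + expSum x N
  expSum-half-step x h x≥0 h≥0 h≤½ zero = p≤p+q 1ℚ 1ℚ _
  expSum-half-step x h x≥0 h≥0 h≤½ (suc N) = begin
    Ey                                ≡⟨ solve 1 (λ e → e := (e :+ :- (con ½ :* e)) :+ (e :+ :- (con ½ :* e))) refl Ey ⟩
    (Ey - ½ * Ey) + (Ey - ½ * Ey)     ≤⟨ +-mono-≤ half half ⟩
    Ex + Ex                           ∎
    where
    open ≤-Reasoning
    open MeanValue x h {{x≥0}} {{h≥0}}
    Ey = expSum y (suc N)
    Ex = expSum x (suc N)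

    half : Ey - ½ * Ey ≤ Ex
    half = begin
      Ey - ½ * Ey              ≤⟨ +-monoˡ-≤ (- (½ * Ey)) (expSum-above N) ⟩
      Ex + h * expSum y N - ½ * Ey
        ≤⟨ +-monoˡ-≤ (- (½ * Ey)) (+-monoʳ-≤ Ex (≤-trans
             (*-monoˡ-≤-nonNeg h {{h≥0}} (expSum-suc-≤ y≥0 N))
             (*-monoʳ-≤-nonNeg Ey {{expSum-nonNeg y≥0 (suc N)}} h≤½))) ⟩
      Ex + ½ * Ey - ½ * Ey     ≡⟨ solve 2 (λ a b → a :+ b :+ :- b := a) refl Ex (½ * Ey) ⟩
      Ex                       ∎

  expSum-0 : ∀ N → expSum 0ℚ N ≡ 1ℚ
  expSum-0 zero    = refl
  expSum-0 (suc N) = trans (cong₂ _+_ (expSum-0 N)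
    (trans (cong (_* recip N) (*-zeroʳ (expTerm 0ℚ N))) (*-zeroˡ (recip N)))) (+-identityʳ 1ℚ)

  -- Steps of ½ bring `x` down to 0, each at most doubling the sum; the last may be shorter, which
  -- is the case `x ≤ ½`.
  expSum≤2^ : ∀ k {x} → 0ℚ ≤ x → x ≤ fromℕ k * ½ → ∀ N → expSum x N ≤ fromℕ (2 ℕ.^ k)
  expSum≤2^ zero 0≤x x≤0 N
    with refl ← ≤-antisym 0≤x (≤-trans x≤0 (≤-reflexive (*-zeroˡ ½))) = ≤-reflexive (expSum-0 N)
  expSum≤2^ (suc k) {x} 0≤x x≤ N with ≤-total x ½
  ... | inj₁ x≤½ = begin
    expSum x N                         ≡⟨ cong (λ z → expSum z N) (+-identityˡ x) ⟨
    expSum (0ℚ + x) N                  ≤⟨ expSum-half-step 0ℚ x _ (nonNegative 0≤x) x≤½ N ⟩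
    expSum 0ℚ N + expSum 0ℚ N          ≡⟨ cong₂ _+_ (expSum-0 N) (expSum-0 N) ⟩
    fromℕ 2                            ≤⟨ fromℕ-mono-≤ (ℕ.^-monoʳ-≤ 2 {1} {suc k} (ℕ.s≤s ℕ.z≤n)) ⟩
    fromℕ (2 ℕ.^ suc k)                ∎
    where open ≤-Reasoning
  ... | inj₂ ½≤x = begin
    expSum x N                         ≡⟨ cong (λ z → expSum z N) (solve 1 (λ x → x := x :+ :- con ½ :+ con ½) refl x) ⟩
    expSum (x - ½ + ½) N               ≤⟨ expSum-half-step (x - ½) ½ (nonNegative 0≤x-½) _ ≤-refl N ⟩
    expSum (x - ½) N + expSum (x - ½) N  ≤⟨ +-mono-≤ ih ih ⟩
    fromℕ (2 ℕ.^ k) + fromℕ (2 ℕ.^ k)  ≡⟨ fromℕ-2^suc k ⟨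
    fromℕ (2 ℕ.^ suc k)                ∎
    where
    open ≤-Reasoning
    0≤x-½ : 0ℚ ≤ x - ½
    0≤x-½ = +-monoˡ-≤ (- ½) ½≤x

    x-½≤ : x - ½ ≤ fromℕ k * ½
    x-½≤ = begin
      x - ½                       ≤⟨ +-monoˡ-≤ (- ½) x≤ ⟩
      fromℕ (suc k) * ½ - ½       ≡⟨ cong (λ z → z * ½ - ½) (fromℕ-+ 1 k) ⟩
      (1ℚ + fromℕ k) * ½ - ½      ≡⟨ solve 1 (λ k → (con 1ℚ :+ k) :* con ½ :+ :- con ½ := k :* con ½) refl (fromℕ k) ⟩
      fromℕ k * ½                 ∎

    ih : expSum (x - ½) N ≤ fromℕ (2 ℕ.^ k)
    ih = expSum≤2^ k 0≤x-½ x-½≤ N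

  -- If `2 x ≤ k`, no partial sum at `x` exceeds `2 ^ k ≤ n`, against `log n < x`. The constant 2
  -- stands in for 1 / log 2 and is the price of steps of ½.
  log-lower : ∀ {k n x} → 2 ℕ.^ k ℕ.≤ n → log n < x → fromℕ k ≤ fromℕ 2 * x
  log-lower {k} {n} {x} 2^k≤n (0≤x , N , n<exp) with ≤-total (fromℕ k) (fromℕ 2 * x)
  ... | inj₁ le = le
  ... | inj₂ ge = contradiction
    (<-≤-trans n<exp (≤-trans (expSum≤2^ k 0≤x x≤k/2 N) (fromℕ-mono-≤ 2^k≤n))) (<-irrefl refl)
    where
    x≤k/2 : x ≤ fromℕ k * ½
    x≤k/2 = subst (_≤ fromℕ k * ½)
      (solve 1 (λ x → con (fromℕ 2) :* x :* con ½ := x) refl x) (*-monoʳ-≤-nonNeg ½ ge)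

  -- Above log 2, so that the doubling in `2^≤expSum` can start here, and below 1, so that `¾ + k`
  -- stays strictly under `k + 1` in `2^≤`.
  ¾ : ℚ
  ¾ = ℤ.+ 3 / 4

  ¾+-nonNeg : ∀ k → NonNegative (¾ + fromℕ k)
  ¾+-nonNeg k = nonNeg+nonNeg⇒nonNeg ¾ (fromℕ k) {{fromℕ-nonNeg k}}

  -- Starting from 1 + ¾ + ¾²/2 ≥ 2, exp at least doubles over each step of 1.
  2^≤expSum : ∀ k → fromℕ (2 ℕ.^ suc k) ≤ expSum (¾ + fromℕ k) (k ℕ.+ 2)
  2^≤expSum zero = toWitness {a? = fromℕ 2 ≤? expSum (¾ + fromℕ 0) 2} tt
  2^≤expSum (suc k) = begin
    fromℕ (2 ℕ.^ suc (suc k))                    ≡⟨ fromℕ-2^suc (suc k) ⟩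
    fromℕ (2 ℕ.^ suc k) + fromℕ (2 ℕ.^ suc k)    ≤⟨ +-mono-≤ ih ih ⟩
    E + E                                        ≤⟨ +-mono-≤ (expSum-suc-≤ (¾+-nonNeg k) (k ℕ.+ 2))
                                                      (≤-reflexive (sym (*-identityˡ E))) ⟩
    expSum x (suc (k ℕ.+ 2)) + 1ℚ * E            ≤⟨ expSum-below (k ℕ.+ 2) ⟩
    expSum (x + 1ℚ) (suc (k ℕ.+ 2))              ≡⟨ cong (λ z → expSum z (suc (k ℕ.+ 2)))
      (trans (+-assoc ¾ (fromℕ k) 1ℚ) (cong (¾ +_) (trans (+-comm (fromℕ k) 1ℚ) (sym (fromℕ-+ 1 k))))) ⟩
    expSum (¾ + fromℕ (suc k)) (suc (k ℕ.+ 2))   ∎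
    where
    open ≤-Reasoning
    x = ¾ + fromℕ k
    E = expSum x (k ℕ.+ 2)
    open MeanValue x 1ℚ {{¾+-nonNeg k}}
    ih = 2^≤expSum k

  -- If `n < 2 ^ (k + 1)`, then `¾ + k` lies in the upper cut of log n, and the hypothesis would
  -- give `k + 1 ≤ ¾ + k`.
  2^≤ : ∀ {M n} → 1 ℕ.≤ n → fromℕ M ≤ 1ℚ ·log n → 2 ℕ.^ M ℕ.≤ n
  2^≤ {zero}  1≤n _ = 1≤n
  2^≤ {suc k} {n} _ M≤log = ℕ.≮⇒≥ λ n<2^M → <-irrefl refl (<-≤-trans
    (subst (¾ + fromℕ k <_) (sym (fromℕ-+ 1 k)) (+-monoˡ-< (fromℕ k) (toWitness {a? = ¾ <? 1ℚ} tt)))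
    (≤-trans (M≤log (¾ + fromℕ k) (nonNegative⁻¹ _ {{¾+-nonNeg k}} , k ℕ.+ 2 ,
        <-≤-trans n<1+n (≤-trans (fromℕ-mono-≤ n<2^M) (2^≤expSum k))))
      (≤-reflexive (*-identityˡ _))))
    where
    n<1+n : fromℕ n < fromℕ (suc n)
    n<1+n = subst₂ _<_ (+-identityˡ (fromℕ n)) (sym (fromℕ-+ 1 n))
      (+-monoˡ-< (fromℕ n) (positive⁻¹ 1ℚ))

open ExpBounds using (fromℕ-*; fromℕ-nonNeg; fromℕ-mono-≤; log-lower; 2^≤)

open import Algebra.Properties.CommutativeSemigroup using (interchange; x∙yz≈y∙xz; x∙yz≈yx∙z)
open import Data.Bool as Bool using (Bool; true; false; T; if_then_else_)
open import Data.Fin as Fin using (Fin; zero; suc; toℕ; combine; fromℕ<)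
import Data.Fin.Properties as Fin
open import Data.Fin.Subset using (Subset; inside; outside; ⊥; ⊤; ⁅_⁆; _∪_; ∣_∣; _⊆_) renaming (_∈_ to _∈ₛ_; _∉_ to _∉ₛ_)
open import Data.Fin.Subset.Properties using (∉⊥; ∈⊤; x∈p∪q⁻; x∈p∪q⁺; x∈⁅x⁆; x∈⁅y⁆⇒x≡y; ∪-identityˡ; ⊆-antisym; ⊆⊤; ∣⊤∣≡n; ∣⊥∣≡0; out⊆; in⊆in; drop-∷-⊆) renaming (_∈?_ to _∈ₛ?_)
open import Data.List using (List; []; _∷_; map; length; filter; allFin; cartesianProduct; cartesianProductWith)
open import Data.List.Membership.Propositional using (_∈_; _∉_)
open import Data.List.Membership.Propositional.Properties using (∈-map⁻; ∈-map⁺; ∈-filter⁺; ∈-filter⁻; ∈-allFin; ∈-cartesianProduct⁺; ∈-cartesianProductWith⁺)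
open import Data.List.Properties using (map-cong-local; map-∘; length-map; length-filter; length-tabulate; length-++)
open import Data.List.Relation.Binary.Subset.Propositional using () renaming (_⊆_ to _⊆ₗ_)
open import Data.List.Relation.Unary.All as All using (All; []; _∷_)
import Data.List.Relation.Unary.All.Properties as All
open import Data.List.Relation.Unary.AllPairs as AllPairs using (AllPairs; []; _∷_)
import Data.List.Relation.Unary.AllPairs.Properties as AllPairs
open import Data.List.Relation.Unary.Any as Any using (Any; here; there)
import Data.List.Relation.Unary.Any.Properties as Any
open import Data.List.Relation.Unary.Unique.Propositional using (Unique)
import Data.List.Relation.Unary.Unique.Propositional.Properties as Unique
open import Data.Nat
open import Data.Nat.ListAction using (product) renaming (sum to sumₗ)
open import Data.Nat.Properties
open import Algebra.Properties.Semiring.Sum +-*-semiring using (sum; sum-cong-≗; ∑-distrib-+; *-distribˡ-sum; *-distribʳ-sum; sum-replicate-zero)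
open import Data.Product using (∃-syntax; _×_; _,_; proj₁; proj₂; curry)
open import Data.Product.Properties using (≡-dec)
open import Data.Rational as ℚ using (ℚ; 0ℚ)
import Data.Rational.Properties as ℚ
open import Data.Sum using (inj₁; inj₂)
open import Data.Vec using (Vec; []; _∷_; here; there; lookup; tabulate)
open import Data.Vec.Properties using ([]=⇒lookup; lookup⇒[]=; lookup∘tabulate)
import Data.Vec.Functional as F
open import Function using (_∘_; id)
open import Level using (0ℓ)
open import Relation.Binary using (DecidableEquality; tri<; tri≈; tri>)
open import Relation.Binary.PropositionalEquality
open import Relation.Nullary
open import Relation.Nullary.Decidable using (dec-true; dec-false; does; ⌊_⌋; toWitness; fromWitness; _→-dec_; _×-dec_)
open import Relation.Unary using (Pred; Decidable)

private variable
  i k m n r : ℕ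

-- Averages over the colours and the method of conditional expectations.

sum-const : ∀ n k → sum {n} (λ _ → k) ≡ n * k
sum-const zero    k = refl
sum-const (suc n) k = cong (k +_) (sum-const n k)

sum-indicator : ∀ {n} (j : Fin n) k → sum (λ i → if does (i Fin.≟ j) then k else 0) ≡ k
sum-indicator {suc n} zero    k = trans (cong (k +_) (sum-replicate-zero n)) (+-identityʳ k)
sum-indicator {suc n} (suc j) k = sum-indicator j k

sum<⇒∃< : ∀ {n b} (t : Fin n → ℕ) → sum t < n * b → ∃[ i ] t i < b
sum<⇒∃< {suc n} {b} t lt with t zero <? b
... | yes t₀<b = zero , t₀<b
... | no  t₀≮b
  with i , tᵢ<b ← sum<⇒∃< (t ∘ suc)
         (+-cancelˡ-< b _ _ (≤-<-trans (+-monoˡ-≤ _ (≮⇒≥ t₀≮b)) lt))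
  = suc i , tᵢ<b

sum-∸ : ∀ {n b a} (t : Fin n → ℕ) → (∀ i → t i ≤ b) → sum t ≡ n * a →
        sum (λ i → b ∸ t i) ≡ n * (b ∸ a)
sum-∸ {n} {b} {a} t t≤b Σt≡na = begin
  Σb∸t                    ≡⟨ m+n∸n≡m Σb∸t (sum t) ⟨
  Σb∸t + sum t ∸ sum t    ≡⟨ cong (_∸ sum t) (∑-distrib-+ _ t) ⟨
  sum (λ i → b ∸ t i + t i) ∸ sum t  ≡⟨ cong (_∸ sum t) (sum-cong-≗ (m∸n+n≡m ∘ t≤b)) ⟩
  sum {n} (λ _ → b) ∸ sum t   ≡⟨ cong₂ _∸_ (sum-const n b) Σt≡na ⟩
  n * b ∸ n * a           ≡⟨ *-distribˡ-∸ n b a ⟨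
  n * (b ∸ a)             ∎
  where
  open ≡-Reasoning
  Σb∸t = sum (λ i → b ∸ t i)

-- Averaging over c commutes with the product, since at most one factor varies.
sum-product : ∀ {A : Set} {V : Pred A 0ℓ} (V? : Decidable V) {q}
              (F : Fin q → A → ℕ) (G : A → ℕ) {xs : List A} →
              (∀ c {x} → ¬ V x → F c x ≡ G x) →
              All (λ x → sum (λ c → F c x) ≡ q * G x) xs →
              AllPairs (λ x y → ¬ (V x × V y)) xs →
              sum (λ c → product (map (F c) xs)) ≡ q * product (map G xs)
sum-product V? {q} F G const [] [] = sum-const q 1
sum-product V? {q} F G {x ∷ xs} const (avg ∷ avgs) (excl ∷ excls) with V? x
... | yes v = begin
  sum (λ c → F c x * product (map (F c) xs))
    ≡⟨ sum-cong-≗ (λ c → cong (λ ys → F c x * product ys)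
         (map-cong-local (All.map (λ ¬vv → const c (λ vy → ¬vv (v , vy))) excl))) ⟩
  sum (λ c → F c x * product (map G xs))
    ≡⟨ *-distribʳ-sum (product (map G xs)) (λ c → F c x) ⟨
  sum (λ c → F c x) * product (map G xs)
    ≡⟨ cong (_* product (map G xs)) avg ⟩
  q * G x * product (map G xs)
    ≡⟨ *-assoc q _ _ ⟩
  q * (G x * product (map G xs)) ∎
  where open ≡-Reasoning
... | no ¬v = begin
  sum (λ c → F c x * product (map (F c) xs))
    ≡⟨ sum-cong-≗ (λ c → cong (_* product (map (F c) xs)) (const c ¬v)) ⟩
  sum (λ c → G x * product (map (F c) xs))
    ≡⟨ *-distribˡ-sum (G x) (λ c → product (map (F c) xs)) ⟨
  G x * sum (λ c → product (map (F c) xs))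
    ≡⟨ cong (G x *_) (sum-product V? F G const avgs excls) ⟩
  G x * (q * product (map G xs))
    ≡⟨ x∙yz≈y∙xz *-commutativeSemigroup (G x) q _ ⟩
  q * (G x * product (map G xs)) ∎
  where open ≡-Reasoning

product≤ : ∀ {A : Set} (g : A → ℕ) {b} → (∀ x → g x ≤ b) → ∀ xs → product (map g xs) ≤ b ^ length xs
product≤ g g≤b []       = ≤-refl
product≤ g g≤b (x ∷ xs) = *-mono-≤ (g≤b x) (product≤ g g≤b xs)

sumₗ-map≤ : ∀ {A : Set} (g : A → ℕ) {b} {xs} → All (λ x → g x ≤ b) xs → sumₗ (map g xs) ≤ length xs * b
sumₗ-map≤ g []         = z≤n
sumₗ-map≤ g (g≤b ∷ gs) = +-mono-≤ g≤b (sumₗ-map≤ g gs)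

-- The method of conditional expectations.  A demand prescribes colours of some
-- points; each task is a list of D-point demands with disjoint supports, one of
-- which must be met.
module Hitting {E : Set} (_≟_ : DecidableEquality E) (q : ℕ) .{{_ : NonZero q}} (D : ℕ) where
  open import Data.List.Membership.DecPropositional _≟_ using (_∈?_)

  Demand = List (E × Fin q)

  keys : Demand → List E
  keys = map proj₁

  Meets : (E → Fin q) → Demand → Set
  Meets χ d = All (λ (e , c) → χ e ≡ c) d

  -- This makes expectations multiply: no point occurs twice in a demand or in two demands of a
  -- task, so recolouring one point changes at most one factor of each product.
  record Valid (task : List Demand) : Set where
    constructor valid
    field
      size     : All (λ d → length d ≡ D) task
      unique   : All (Unique ∘ keys) task
      disjoint : AllPairs (λ d d′ → ∀ e → ¬ (e ∈ keys d × e ∈ keys d′)) task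

  -- The points of es are still to be coloured; factor is q times the
  -- conditional probability of the event χ e = c.
  factor : List E → (E → Fin q) → E × Fin q → ℕ
  factor es χ (e , c) = if does (e ∈? es) then 1 else if does (χ e Fin.≟ c) then q else 0

  -- In units of `q ^ D`, the conditional probabilities that a demand is met or missed. For a task
  -- of `R` demands the unit becomes `(q ^ D) ^ R`.
  successes failures : List E → (E → Fin q) → Demand → ℕ
  successes es χ d = product (map (factor es χ) d)
  failures  es χ d = q ^ D ∸ successes es χ d

  taskFailures : List E → (E → Fin q) → List Demand → ℕ
  taskFailures es χ task = product (map (failures es χ) task)

  factor≤q : ∀ es χ x → factor es χ x ≤ q
  factor≤q es χ (e , c) with does (e ∈? es) | does (χ e Fin.≟ c)
  ... | true  | _     = >-nonZero⁻¹ q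
  ... | false | true  = ≤-refl
  ... | false | false = z≤n

  successes≤ : ∀ es χ {d} → length d ≡ D → successes es χ d ≤ q ^ D
  successes≤ es χ {d} refl = product≤ (factor es χ) (factor≤q es χ) d

  _[_≔_] : (E → Fin q) → E → Fin q → (E → Fin q)
  (χ [ e ≔ c ]) e′ = if does (e′ ≟ e) then c else χ e′

  module _ {e : E} {es : List E} (e∉es : e ∉ es) (χ : E → Fin q) where
    factor-other : ∀ c {x} → proj₁ x ≢ e →
                   factor es (χ [ e ≔ c ]) x ≡ factor (e ∷ es) χ x
    factor-other c {e′ , _} e′≢e rewrite dec-false (e′ ≟ e) e′≢e = refl

    factor-this : ∀ x → sum (λ c → factor es (χ [ e ≔ c ]) x) ≡ q * factor (e ∷ es) χ x
    factor-this x@(e′ , c′) with e′ ≟ e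
    ... | yes refl rewrite dec-false (e ∈? es) e∉es =
      trans (sum-indicator c′ q) (sym (*-identityʳ q))
    ... | no e′≢e = sum-const q _

    successes-other : ∀ c {d} → e ∉ keys d →
                      successes es (χ [ e ≔ c ]) d ≡ successes (e ∷ es) χ d
    successes-other c e∉d = cong product (map-cong-local
      (All.map (λ e≢ → factor-other c (e≢ ∘ sym)) (All.map⁻ (All.¬Any⇒All¬ _ e∉d))))

    successes-average : ∀ {d} → Unique (keys d) →
      sum (λ c → successes es (χ [ e ≔ c ]) d) ≡ q * successes (e ∷ es) χ d
    successes-average {d} unique = sum-product (λ x → proj₁ x ≟ e) (λ c → factor es (χ [ e ≔ c ])) _ factor-other
      (All.universal factor-this d)
      (AllPairs.map (λ { x≢y (refl , refl) → x≢y refl }) (AllPairs.map⁻ unique))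

    taskFailures-average : ∀ {task} → Valid task →
      sum (λ c → taskFailures es (χ [ e ≔ c ]) task) ≡ q * taskFailures (e ∷ es) χ task
    taskFailures-average (valid size unique disjoint) =
      sum-product (λ d → e ∈? keys d) (λ c → failures es (χ [ e ≔ c ])) _
        (λ c {d} e∉d → cong (q ^ D ∸_) (successes-other c {d} e∉d))
        (All.zipWith (λ {d} (s , u) → sum-∸ (λ c → successes es (χ [ e ≔ c ]) d)
           (λ c → successes≤ es (χ [ e ≔ c ]) {d} s) (successes-average {d} u)) (size , unique))
        (AllPairs.map (λ dis → dis e) disjoint)

    totalFailures-average : ∀ {tasks} → All Valid tasks →
      sum (λ c → sumₗ (map (taskFailures es (χ [ e ≔ c ])) tasks)) ≡
      q * sumₗ (map (taskFailures (e ∷ es) χ) tasks)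
    totalFailures-average [] = trans (sum-const q 0) refl
    totalFailures-average {task ∷ tasks} (v ∷ vs) = trans
      (∑-distrib-+ (λ c → taskFailures es (χ [ e ≔ c ]) task)
        (λ c → sumₗ (map (taskFailures es (χ [ e ≔ c ])) tasks)))
      (trans (cong₂ _+_ (taskFailures-average v) (totalFailures-average vs))
        (sym (*-distribˡ-+ q (taskFailures (e ∷ es) χ task) _)))

  -- The current total is the mean of the totals over the colours of the next point, so some colour
  -- keeps it below `b`.
  colouring-below : ∀ {tasks b} → All Valid tasks → ∀ es → Unique es → ∀ χ →
    sumₗ (map (taskFailures es χ) tasks) < b →
    ∃[ χ′ ] sumₗ (map (taskFailures [] χ′) tasks) < b
  colouring-below vs []       _ χ lt = χ , lt
  colouring-below {tasks} vs (e ∷ es) u@(_ ∷ u′) χ lt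
    with c , lt′ ← sum<⇒∃< {q} (λ c → sumₗ (map (taskFailures es (χ [ e ≔ c ])) tasks))
           (subst (_< _) (sym (totalFailures-average (Unique.Unique[x∷xs]⇒x∉xs u) χ vs)) (*-monoʳ-< q lt))
    = colouring-below vs es u′ (χ [ e ≔ c ]) lt′

  ¬meets⇒successes≡0 : ∀ χ d → ¬ Meets χ d → successes [] χ d ≡ 0
  ¬meets⇒successes≡0 χ []            ¬m = contradiction [] ¬m
  ¬meets⇒successes≡0 χ ((e , c) ∷ d) ¬m with χ e Fin.≟ c
  ... | no  _  = refl
  ... | yes eq rewrite ¬meets⇒successes≡0 χ d (¬m ∘ (eq ∷_)) = *-zeroʳ q

  -- Once everything is coloured, an unmet demand contributes the full `q ^ D`; a product short of
  -- the full power therefore contains a demand that is met.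
  hit : ∀ χ task → taskFailures [] χ task < (q ^ D) ^ length task → Any (Meets χ) task
  hit χ []         lt = contradiction lt (<-irrefl refl)
  hit χ (d ∷ task) lt with All.all? (λ (e , c) → χ e Fin.≟ c) d
  ... | yes m = here m
  ... | no ¬m rewrite ¬meets⇒successes≡0 χ d ¬m = there (hit χ task (*-cancelˡ-< (q ^ D) _ _ lt))

  sumₗ<⇒All< : ∀ {A : Set} (g : A → ℕ) {b} xs → sumₗ (map g xs) < b → All (λ x → g x < b) xs
  sumₗ<⇒All< g []       lt = []
  sumₗ<⇒All< g (x ∷ xs) lt = ≤-<-trans (m≤m+n _ _) lt ∷ sumₗ<⇒All< g xs (≤-<-trans (m≤n+m _ _) lt)

  factor-open : ∀ {es} χ → (∀ e → e ∈ es) → ∀ x → factor es χ x ≡ 1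
  factor-open {es} χ all (e , c) rewrite dec-true (e ∈? es) (all e) = refl

  product-1 : ∀ {A : Set} (g : A → ℕ) → (∀ x → g x ≡ 1) → ∀ xs → product (map g xs) ≡ 1
  product-1 g g≡1 []       = refl
  product-1 g g≡1 (x ∷ xs) rewrite g≡1 x | product-1 g g≡1 xs = refl

  χ₀ : E → Fin q
  χ₀ _ = Fin.fromℕ< (>-nonZero⁻¹ q)

  colouring : ∀ es → Unique es → (∀ e → e ∈ es) →
    ∀ {R} tasks → All Valid tasks → All (λ task → length task ≡ R) tasks →
    length tasks * (q ^ D ∸ 1) ^ R < (q ^ D) ^ R →
    ∃[ χ ] All (Any (Meets χ)) tasks
  colouring es u all {R} tasks vs lens lt
    with χ , lt′ ← colouring-below vs es u χ₀
      -- While every point is open, a demand has success 1 out of `q ^ D`, so each task starts at no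
      -- more than `(q ^ D ∸ 1) ^ R`.
      (≤-<-trans (sumₗ-map≤ (taskFailures es χ₀) (All.map (λ {task} → λ { refl →
          product≤ (failures es χ₀) (λ d → ≤-reflexive (cong (q ^ D ∸_) (product-1 (factor es χ₀) (factor-open χ₀ all) d)))
            task }) lens)) lt)
    = χ , All.zipWith (λ { {task} (refl , lt″) → hit χ task lt″ }) (lens , sumₗ<⇒All< _ tasks lt′)

-- Increasing enumerations and images of vertex sets.

Injective : (Fin r → Fin n) → Set
Injective v = ∀ {i j} → v i ≡ v j → i ≡ j

Increasing : (Fin r → Fin n) → Set
Increasing v = ∀ {i j} → i Fin.< j → v i Fin.< v j

increasing⇒injective : {v : Fin r → Fin n} → Increasing v → Injective v
increasing⇒injective inc {i} {j} eq with Fin.<-cmp i j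
... | tri< i<j _ _ = contradiction (inc i<j) (Fin.<-irrefl eq)
... | tri≈ _ i≡j _ = i≡j
... | tri> _ _ j<i = contradiction (inc j<i) (Fin.<-irrefl (sym eq))

increasing-cancel : {v : Fin r → Fin n} → Increasing v → ∀ {i j} → v i Fin.< v j → i Fin.< j
increasing-cancel {v = v} inc {i} {j} lt with Fin.<-cmp i j
... | tri< i<j _ _ = i<j
... | tri≈ _ i≡j _ = contradiction lt (Fin.<-irrefl (cong v i≡j))
... | tri> _ _ j<i = contradiction (inc j<i) (Fin.<-asym lt)

increasing? : (v : Fin r → Fin n) → Dec (∀ i j → i Fin.< j → v i Fin.< v j)
increasing? v = Fin.all? λ i → Fin.all? λ j → (i Fin.<? j) →-dec (v i Fin.<? v j)

choose : ∀ r (S : Subset n) → r ≤ ∣ S ∣ → ∃[ v ] (Increasing {r} v × ∀ i → v i ∈ₛ S)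
choose zero S _ = (λ ()) , (λ { {()} }) , λ ()
choose (suc r) (outside ∷ S) le with v , inc , ∈S ← choose (suc r) S le =
  suc ∘ v , s≤s ∘ inc , there ∘ ∈S
choose {suc n} (suc r) (inside ∷ S) (s≤s le) with v , inc , ∈S ← choose r S le =
  v′ , inc′ , λ { zero → here ; (suc i) → there (∈S i) }
  where
  v′ : Fin (suc r) → Fin (suc n)
  v′ = zero F.∷ suc ∘ v

  inc′ : Increasing v′
  inc′ {zero}  {suc j} _         = z<s
  inc′ {suc i} {suc j} (s≤s i<j) = s≤s (inc i<j)

∣⁅x⁆∪p∣≡1+∣p∣ : ∀ {x : Fin n} {p} → x ∉ₛ p → ∣ ⁅ x ⁆ ∪ p ∣ ≡ suc ∣ p ∣
∣⁅x⁆∪p∣≡1+∣p∣ {x = zero}  {inside  ∷ p} x∉p = contradiction here x∉p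
∣⁅x⁆∪p∣≡1+∣p∣ {x = zero}  {outside ∷ p} x∉p = cong (suc ∘ ∣_∣) (∪-identityˡ p)
∣⁅x⁆∪p∣≡1+∣p∣ {x = suc x} {inside  ∷ p} x∉p = cong suc (∣⁅x⁆∪p∣≡1+∣p∣ (x∉p ∘ there))
∣⁅x⁆∪p∣≡1+∣p∣ {x = suc x} {outside ∷ p} x∉p = ∣⁅x⁆∪p∣≡1+∣p∣ (x∉p ∘ there)

image : (Fin r → Fin n) → Subset r → Subset n
image v []            = ⊥
image v (outside ∷ e) = image (v ∘ suc) e
image v (inside  ∷ e) = ⁅ v zero ⁆ ∪ image (v ∘ suc) e

∈-image⁺ : (v : Fin r → Fin n) {e : Subset r} → ∀ {i} → i ∈ₛ e → v i ∈ₛ image v e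
∈-image⁺ v {inside  ∷ e} here        = x∈p∪q⁺ (inj₁ (x∈⁅x⁆ (v zero)))
∈-image⁺ v {inside  ∷ e} (there i∈e) = x∈p∪q⁺ (inj₂ (∈-image⁺ (v ∘ suc) i∈e))
∈-image⁺ v {outside ∷ e} (there i∈e) = ∈-image⁺ (v ∘ suc) i∈e

∈-image⁻ : (v : Fin r → Fin n) (e : Subset r) → ∀ {x} → x ∈ₛ image v e → ∃[ i ] (i ∈ₛ e × v i ≡ x)
∈-image⁻ v []            x∈ = contradiction x∈ ∉⊥
∈-image⁻ v (outside ∷ e) x∈ with i , i∈e , eq ← ∈-image⁻ (v ∘ suc) e x∈ = suc i , there i∈e , eq
∈-image⁻ v (inside  ∷ e) x∈ with x∈p∪q⁻ ⁅ v zero ⁆ _ x∈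
... | inj₁ x∈⁅v₀⁆ = zero , here , sym (x∈⁅y⁆⇒x≡y _ x∈⁅v₀⁆)
... | inj₂ x∈im with i , i∈e , eq ← ∈-image⁻ (v ∘ suc) e x∈im = suc i , there i∈e , eq

image-mono : (v : Fin r → Fin n) {e e′ : Subset r} → e ⊆ e′ → image v e ⊆ image v e′
image-mono v {e} e⊆e′ x∈ with i , i∈e , refl ← ∈-image⁻ v e x∈ = ∈-image⁺ v (e⊆e′ i∈e)

∣image∣ : {v : Fin r → Fin n} → Injective v → ∀ e → ∣ image v e ∣ ≡ ∣ e ∣
∣image∣ {n = n} inj [] = ∣⊥∣≡0 n
∣image∣ inj (outside ∷ e) = ∣image∣ (Fin.suc-injective ∘ inj) e
∣image∣ {v = v} inj (inside ∷ e) = trans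
  (∣⁅x⁆∪p∣≡1+∣p∣ λ v₀∈ → let i , _ , eq = ∈-image⁻ (v ∘ suc) e v₀∈ in Fin.0≢1+n (sym (inj eq)))
  (cong suc (∣image∣ (Fin.suc-injective ∘ inj) e))

⊆-image⁻ : {v : Fin r → Fin n} → Injective v → ∀ {e S} → e ⊆ image v S →
           ∃[ e′ ] (e′ ⊆ S × image v e′ ≡ e)
⊆-image⁻ {v = v} inj {e} {S} e⊆ = e′ , e′⊆S , ⊆-antisym image⊆ ⊆image
  where
  e′ = tabulate (lookup e ∘ v)

  ∈e′⁻ : ∀ {i} → i ∈ₛ e′ → v i ∈ₛ e
  ∈e′⁻ {i} i∈ = lookup⇒[]= (v i) e (trans (sym (lookup∘tabulate _ i)) ([]=⇒lookup i∈))

  ∈e′⁺ : ∀ {i} → v i ∈ₛ e → i ∈ₛ e′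
  ∈e′⁺ {i} vi∈ = lookup⇒[]= i e′ (trans (lookup∘tabulate _ i) ([]=⇒lookup vi∈))

  e′⊆S : e′ ⊆ S
  e′⊆S i∈ with j , j∈S , eq ← ∈-image⁻ v S (e⊆ (∈e′⁻ i∈)) = subst (_∈ₛ S) (inj eq) j∈S

  image⊆ : image v e′ ⊆ e
  image⊆ x∈ with i , i∈ , refl ← ∈-image⁻ v e′ x∈ = ∈e′⁻ i∈

  ⊆image : e ⊆ image v e′
  ⊆image x∈e with i , _ , refl ← ∈-image⁻ v S (e⊆ x∈e) = ∈-image⁺ v (∈e′⁺ x∈e)

α< : ∀ {s m} → 1 ≤ s → (G : Hypergraph k n) →
     (∀ W → m ≤ ∣ W ∣ → G [ W ]Contains-K s) → α s G < m
α< 1≤s G large with W , free , ∣W∣≡α ← α-attained 1≤s G =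
  subst (_< _) ∣W∣≡α (≰⇒> (free ∘ large W))

-- The 3-uniform hypergraph of a pair colouring.

module _ {q n : ℕ} (χ : Fin n → Fin n → Fin q) where

  Rainbow : Subset n → Set
  Rainbow e = ∀ i j k → i ∈ₛ e → j ∈ₛ e → k ∈ₛ e → i Fin.< j → j Fin.< k → χ i j ≢ χ i k

  rainbow? : ∀ e → Dec (Rainbow e)
  rainbow? e = Fin.all? λ i → Fin.all? λ j → Fin.all? λ k →
    (i ∈ₛ? e) →-dec (j ∈ₛ? e) →-dec (k ∈ₛ? e) →-dec
    (i Fin.<? j) →-dec (j Fin.<? k) →-dec ¬? (χ i j Fin.≟ χ i k)

  rainbowGraph : Hypergraph 3 n
  rainbowGraph .edge? e = ⌊ (∣ e ∣ ≟ 3) ×-dec rainbow? e ⌋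
  rainbowGraph .uniform e edge = proj₁ (toWitness {a? = (∣ e ∣ ≟ 3) ×-dec rainbow? e} edge)

  -- The least vertex of a clique sends distinct colours to all the others.
  rainbowGraph-free : ∀ {t} → suc q < t → ¬ rainbowGraph Contains-K t
  rainbowGraph-free {suc t} (s≤s q<t) (S , _ , ∣S∣≡t , complete)
    with v , inc , v∈S ← choose (suc t) S (≤-reflexive (sym ∣S∣≡t))
    with j , k , j<k , eq ← Fin.pigeonhole q<t (χ (v zero) ∘ v ∘ suc)
    = proj₂ (toWitness {a? = (∣ e ∣ ≟ 3) ×-dec rainbow? e}
               (complete e e⊆S (∣image∣ (increasing⇒injective w-inc) ⊤)))
        _ _ _ (w∈e zero) (w∈e (suc zero)) (w∈e (suc (suc zero)))
        (inc z<s) (inc (s≤s j<k)) eq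
    where
    w : Fin 3 → Fin n
    w = v zero F.∷ v (suc j) F.∷ v (suc k) F.∷ F.[]

    w-inc : Increasing w
    w-inc {zero}     {suc zero}       _ = inc z<s
    w-inc {zero}     {suc (suc zero)} _ = inc z<s
    w-inc {suc zero} {suc (suc zero)} _ = inc (s≤s j<k)
    w-inc {suc zero} {suc zero} (s≤s ())
    w-inc {suc (suc zero)} {suc zero} (s≤s ())
    w-inc {suc (suc zero)} {suc (suc zero)} (s≤s (s≤s ()))

    e : Subset n
    e = image w ⊤

    w∈e : ∀ i → w i ∈ₛ e
    w∈e i = ∈-image⁺ w {⊤} {i} ∈⊤

    e⊆S : e ⊆ S
    e⊆S x∈e with ∈-image⁻ w ⊤ x∈e
    ... | zero , _ , refl = v∈S zero
    ... | suc zero , _ , refl = v∈S (suc j)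
    ... | suc (suc zero) , _ , refl = v∈S (suc k)

  -- The prescribed colour of a pair depends only on its later end, so an earlier vertex sees any
  -- two later ones in different colours.
  rainbowClique : ∀ {W} (v : Fin (suc q) → Fin n) → Increasing v → (∀ x → v x ∈ₛ W) →
                  (∀ x c → toℕ x ≤ toℕ c → χ (v x) (v (suc c)) ≡ c) →
                  rainbowGraph [ W ]Contains-K (suc q)
  rainbowClique {W} v inc v∈W colour =
    image v ⊤ , im⊆W , trans (∣image∣ (increasing⇒injective inc) ⊤) (∣⊤∣≡n (suc q)) ,
    λ e e⊆ ∣e∣≡3 → fromWitness {a? = (∣ e ∣ ≟ 3) ×-dec rainbow? e} (∣e∣≡3 , rainbow e⊆)
    where
    im⊆W : image v ⊤ ⊆ W
    im⊆W x∈ with i , _ , refl ← ∈-image⁻ v ⊤ x∈ = v∈W i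

    rainbow : ∀ {e} → e ⊆ image v ⊤ → Rainbow e
    rainbow e⊆ i j k i∈ j∈ k∈ i<j j<k eq
      with x , _ , refl ← ∈-image⁻ v ⊤ (e⊆ i∈)
         | y , _ , refl ← ∈-image⁻ v ⊤ (e⊆ j∈)
         | z , _ , refl ← ∈-image⁻ v ⊤ (e⊆ k∈)
      -- Something precedes `y` and `z`, so both are successors, and their colours satisfy `c < c′`.
      with suc c ← y | suc c′ ← z | s≤s x≤c ← increasing-cancel inc i<j | y<z@(s≤s c<c′) ← increasing-cancel inc j<k
      = Fin.<⇒≢ c<c′ (trans (sym (colour x c x≤c))
          (trans eq (colour x c′ (≤-trans x≤c (<⇒≤ c<c′)))))

-- Pair-disjoint candidate cliques from the lines of a grid.

length-cartesianProductWith : ∀ {A B C : Set} (g : A → B → C) xs ys →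
  length (cartesianProductWith g xs ys) ≡ length xs * length ys
length-cartesianProductWith g []       ys = refl
length-cartesianProductWith g (x ∷ xs) ys = trans (length-++ (map (g x) ys))
  (cong₂ _+_ (length-map (g x) ys) (length-cartesianProductWith g xs ys))

vectors : ∀ m n → List (Vec (Fin n) m)
vectors zero    n = [] ∷ []
vectors (suc m) n = cartesianProductWith _∷_ (allFin n) (vectors m n)

length-vectors : ∀ m n → length (vectors m n) ≡ n ^ m
length-vectors zero    n = refl
length-vectors (suc m) n = trans (length-cartesianProductWith _∷_ (allFin n) (vectors m n))
  (cong₂ _*_ (length-tabulate {n = n} id) (length-vectors m n))

∈-vectors : ∀ {m n} (v : Vec (Fin n) m) → v ∈ vectors m n
∈-vectors []      = here refl
∈-vectors (x ∷ v) = ∈-cartesianProductWith⁺ _∷_ (∈-allFin x) (∈-vectors v)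

-- Subtracting the equations at the distinct columns `x` and `c + 1` leaves the slopes times a
-- positive number; `shift` performs the subtraction without leaving ℕ.
line-injective : ∀ {a a′ b b′ x c} → x ≤ c →
  a * x + b ≡ a′ * x + b′ → a * suc c + b ≡ a′ * suc c + b′ → a ≡ a′ × b ≡ b′
line-injective {a} {a′} {b} {b′} {x} x≤c eq eq′
  with d , refl ← m≤n⇒∃[o]m+o≡n x≤c = a≡a′ , b≡b′
  where
  open ≡-Reasoning

  shift : ∀ a b → a * suc (x + d) + b ≡ a * suc d + (a * x + b)
  shift a b = begin
    a * suc (x + d) + b       ≡⟨ cong (λ y → a * y + b) (trans (sym (+-suc x d)) (+-comm x (suc d))) ⟩
    a * (suc d + x) + b       ≡⟨ cong (_+ b) (*-distribˡ-+ a (suc d) x) ⟩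
    a * suc d + a * x + b     ≡⟨ +-assoc (a * suc d) _ _ ⟩
    a * suc d + (a * x + b)   ∎

  a≡a′ : a ≡ a′
  a≡a′ = *-cancelʳ-≡ a a′ (suc d) (+-cancelʳ-≡ (a * x + b) _ _ (begin
    a * suc d + (a * x + b)    ≡⟨ shift a b ⟨
    a * suc (x + d) + b        ≡⟨ eq′ ⟩
    a′ * suc (x + d) + b′      ≡⟨ shift a′ b′ ⟩
    a′ * suc d + (a′ * x + b′) ≡⟨ cong (a′ * suc d +_) eq ⟨
    a′ * suc d + (a * x + b)   ∎))

  b≡b′ : b ≡ b′
  b≡b′ = +-cancelˡ-≡ (a * x) _ _ (trans eq (cong (λ a → a * x + b′) (sym a≡a′)))

module _ (q : ℕ) .{{_ : NonZero q}} where

  -- A clique on v₀ < … < v_q is sought with χ(vₓ, v_{c+1}) = c for x ≤ c.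
  cliquePairs : List (Fin (suc q) × Fin q)
  cliquePairs = filter (λ (x , c) → toℕ x ≤? toℕ c) (cartesianProduct (allFin (suc q)) (allFin q))

  cliquePairs-≤ : ∀ {x c} → (x , c) ∈ cliquePairs → toℕ x ≤ toℕ c
  cliquePairs-≤ xc∈ = proj₂ (∈-filter⁻ (λ (x , c) → toℕ x ≤? toℕ c)
    {xs = cartesianProduct (allFin (suc q)) (allFin q)} xc∈)

  -- This is the number q(q+1)/2 of pairs in an s-set: each pair of indices occurs once as `x` and
  -- `c + 1`.
  D : ℕ
  D = length cliquePairs

  module Lines (r n : ℕ) where
    private s = suc q

    open Hitting {Fin n × Fin n} (≡-dec Fin._≟_ Fin._≟_) q D

    size : ℕ
    size = s * (s * r)

    height< : ∀ (a b : Fin r) (x : Fin s) → toℕ a * toℕ x + toℕ b < s * r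
    height< a b x = begin-strict
      toℕ a * toℕ x + toℕ b <⟨ +-monoʳ-< (toℕ a * toℕ x) (Fin.toℕ<n b) ⟩
      toℕ a * toℕ x + r     ≤⟨ +-monoˡ-≤ r (*-mono-≤ (<⇒≤ (Fin.toℕ<n a)) (s≤s⁻¹ (Fin.toℕ<n x))) ⟩
      r * q + r             ≡⟨ +-comm (r * q) r ⟩
      r + r * q             ≡⟨ cong (r +_) (*-comm r q) ⟩
      s * r                 ∎
      where open ≤-Reasoning

    -- The points (x, ax + b) of a grid with `s` columns of height `s * r`: there are `r * r` lines
    -- on only `s * s * r` points. The column is the major coordinate of `combine`, so a line is
    -- increasing whatever its slope.
    line : Fin r × Fin r → Fin s → Fin size
    line (a , b) x = combine x (fromℕ< (height< a b x))

    line-increasing : ∀ ab → Increasing (line ab)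
    line-increasing (a , b) {x} {y} = Fin.combine-monoˡ-< (fromℕ< (height< a b x)) (fromℕ< (height< a b y))

    heights≡ : ∀ {a b a′ b′} x → fromℕ< (height< a b x) ≡ fromℕ< (height< a′ b′ x) →
               toℕ a * toℕ x + toℕ b ≡ toℕ a′ * toℕ x + toℕ b′
    heights≡ {a} {b} {a′} {b′} x eq = trans (sym (Fin.toℕ-fromℕ< (height< a b x)))
      (trans (cong toℕ eq) (Fin.toℕ-fromℕ< (height< a′ b′ x)))

    -- A shared pair fixes both columns and the heights of both lines there. This is what keeps the
    -- demands of different lines disjoint.
    line-meet : ∀ {ab ab′ x x′ c c′} → toℕ x ≤ toℕ c →
      line ab x ≡ line ab′ x′ → line ab (suc c) ≡ line ab′ (suc c′) → ab ≡ ab′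
    line-meet {a , b} {a′ , b′} {x} {x′} {c} {c′} x≤c eq eq′
      with refl , h ← Fin.combine-injective x (fromℕ< (height< a b x)) x′ (fromℕ< (height< a′ b′ x′)) eq
         | refl , h′ ← Fin.combine-injective (suc c) (fromℕ< (height< a b (suc c)))
                         (suc c′) (fromℕ< (height< a′ b′ (suc c′))) eq′
      with a≡ , b≡ ← line-injective x≤c (heights≡ {a} {b} {a′} {b′} x h) (heights≡ {a} {b} {a′} {b′} (suc c) h′)
      = cong₂ _,_ (Fin.toℕ-injective a≡) (Fin.toℕ-injective b≡)

    -- The map `w` places the grid on vertices of the hypergraph; the union bound ranges over such
    -- placements.
    module _ (w : Fin size → Fin n) where
      key : Fin r × Fin r → Fin s × Fin q → Fin n × Fin n
      key ab (x , c) = w (line ab x) , w (line ab (suc c))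

      demand : Fin r × Fin r → Demand
      demand ab = map (λ xc → key ab xc , proj₂ xc) cliquePairs

      task : List Demand
      task = map demand (cartesianProduct (allFin r) (allFin r))

      length-task : length task ≡ r * r
      length-task = trans (length-map demand (cartesianProduct (allFin r) (allFin r)))
        (trans (length-cartesianProductWith _,_ (allFin r) (allFin r))
          (cong₂ _*_ (length-tabulate {n = r} id) (length-tabulate {n = r} id)))

      keys-demand : ∀ ab → keys (demand ab) ≡ map (key ab) cliquePairs
      keys-demand ab = sym (map-∘ cliquePairs)

      task-valid : Injective w → Valid task
      task-valid inj = valid
        (All.map⁺ (All.universal (λ ab → length-map _ cliquePairs) _))
        (All.map⁺ (All.universal (λ ab → subst Unique (sym (keys-demand ab))
          (Unique.map⁺ (key-injective ab) cliquePairs-unique)) _))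
        (AllPairs.map⁺ (AllPairs.map disjoint
          (Unique.cartesianProduct⁺ (Unique.allFin⁺ r) (Unique.allFin⁺ r))))
        where
        cliquePairs-unique : Unique cliquePairs
        cliquePairs-unique = Unique.filter⁺ _ (Unique.cartesianProduct⁺ (Unique.allFin⁺ s) (Unique.allFin⁺ q))

        key-injective : ∀ ab {xc yd} → key ab xc ≡ key ab yd → xc ≡ yd
        key-injective ab eq = cong₂ _,_ (line-inj (cong proj₁ eq)) (Fin.suc-injective (line-inj (cong proj₂ eq)))
          where
          line-inj : ∀ {x y} → w (line ab x) ≡ w (line ab y) → x ≡ y
          line-inj = increasing⇒injective (line-increasing ab) ∘ inj

        disjoint : ∀ {ab ab′} → ab ≢ ab′ → ∀ e → ¬ (e ∈ keys (demand ab) × e ∈ keys (demand ab′))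
        disjoint {ab} {ab′} ab≢ab′ e (e∈ , e∈′)
          with (x , c) , xc∈ , refl ← ∈-map⁻ (key ab) (subst (e ∈_) (keys-demand ab) e∈)
             | (x′ , c′) , _ , eq ← ∈-map⁻ (key ab′) (subst (e ∈_) (keys-demand ab′) e∈′)
          = ab≢ab′ (line-meet {x = x} {x′} {c} {c′} (cliquePairs-≤ xc∈)
                     (inj (cong proj₁ eq)) (inj (cong proj₂ eq)))

    Cliques : (Fin n × Fin n → Fin q) → (Fin size → Fin n) → Set
    Cliques χ w = ∃[ ab ] ∀ x c → toℕ x ≤ toℕ c → χ (key w ab (x , c)) ≡ c

    -- Placements are enumerated as vectors, and a function agrees with its tabulation only
    -- pointwise.
    cliques-cong : ∀ {χ w w′} → w ≗ w′ → Cliques χ w → Cliques χ w′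
    cliques-cong {χ} w≗w′ (ab , colours) = ab , λ x c x≤c →
      trans (sym (cong₂ (curry χ) (w≗w′ (line ab x)) (w≗w′ (line ab (suc c))))) (colours x c x≤c)

    met-line : ∀ {χ} w → Any (Meets χ) (task w) → Cliques χ w
    met-line w met with ab , meets ← Any.satisfied (Any.map⁻ met) =
      ab , λ x c x≤c → All.lookup (All.map⁻ meets)
        (∈-filter⁺ (λ (x , c) → toℕ x ≤? toℕ c) (∈-cartesianProduct⁺ (∈-allFin x) (∈-allFin c)) x≤c)

    colouring-with-cliques : n ^ size * (q ^ D ∸ 1) ^ (r * r) < (q ^ D) ^ (r * r) →
      ∃[ χ ] ∀ w → Increasing w → Cliques (λ (i , j) → χ i j) w
    colouring-with-cliques lt = curry (proj₁ hits) , good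
      where
      -- Restricting to increasing placements makes every task valid; their number is still bounded
      -- by that of all vectors.
      increasing-vectors : List (Vec (Fin n) size)
      increasing-vectors = filter (increasing? ∘ lookup) (vectors size n)

      tasks : List (List Demand)
      tasks = map (task ∘ lookup) increasing-vectors

      length-tasks : length tasks ≤ n ^ size
      length-tasks = begin
        length tasks               ≡⟨ length-map _ increasing-vectors ⟩
        length increasing-vectors  ≤⟨ length-filter (increasing? ∘ lookup) (vectors size n) ⟩
        length (vectors size n)    ≡⟨ length-vectors size n ⟩
        n ^ size                   ∎
        where open ≤-Reasoning

      tasks-valid : All Valid tasks
      tasks-valid = All.map⁺ (All.map
        (λ {v} inc → task-valid (lookup v) (increasing⇒injective (inc _ _)))
        (All.all-filter (increasing? ∘ lookup) (vectors size n)))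

      hits : ∃[ χ ] All (Any (Meets χ)) tasks
      hits = colouring (cartesianProduct (allFin n) (allFin n))
        (Unique.cartesianProduct⁺ (Unique.allFin⁺ n) (Unique.allFin⁺ n))
        (λ (i , j) → ∈-cartesianProduct⁺ (∈-allFin i) (∈-allFin j))
        tasks tasks-valid
        (All.map⁺ (All.universal (length-task ∘ lookup) increasing-vectors))
        (≤-<-trans (*-monoˡ-≤ _ length-tasks) lt)

      tabulated : ∀ w → Increasing w → ∀ i j → i Fin.< j → lookup (tabulate w) i Fin.< lookup (tabulate w) j
      tabulated w inc i j i<j = subst₂ Fin._<_ (sym (lookup∘tabulate w i)) (sym (lookup∘tabulate w j)) (inc i<j)

      good : ∀ w → Increasing w → Cliques (proj₁ hits) w
      good w inc = cliques-cong {proj₁ hits} (lookup∘tabulate w) (met-line {proj₁ hits} (lookup (tabulate w))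
        (All.lookup (All.map⁻ {xs = increasing-vectors} (proj₂ hits))
          (∈-filter⁺ (increasing? ∘ lookup) (∈-vectors (tabulate w)) (tabulated w inc))))

    f-upper : n ^ size * (q ^ D ∸ 1) ^ (r * r) < (q ^ D) ^ (r * r) →
              ∀ {t} → suc q < t → f 3 (suc q) t n < size
    f-upper lt s<t = ≤-<-trans (f-lower z<s (rainbowGraph χ) (rainbowGraph-free χ s<t))
      (α< z<s (rainbowGraph χ) λ W size≤∣W∣ →
        let w , inc , w∈W = choose size W size≤∣W∣
            ab , colours  = cliques w inc
        in rainbowClique χ (w ∘ line ab) (inc ∘ line-increasing ab) (w∈W ∘ line ab) colours)
      where
      χ       = proj₁ (colouring-with-cliques lt)
      cliques = proj₂ (colouring-with-cliques lt)

-- Removing the first element of a subset, and majority filtering.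

dropFirst : Subset n → Subset n
dropFirst []            = []
dropFirst (inside  ∷ S) = outside ∷ S
dropFirst (outside ∷ S) = outside ∷ dropFirst S

dropFirst⊆ : (S : Subset n) → dropFirst S ⊆ S
dropFirst⊆ (inside  ∷ S) (there x∈) = there x∈
dropFirst⊆ (outside ∷ S) (there x∈) = there (dropFirst⊆ S x∈)

∣dropFirst∣ : ∀ (S : Subset n) {k} → ∣ S ∣ ≡ suc k → ∣ dropFirst S ∣ ≡ k
∣dropFirst∣ (inside  ∷ S) eq = suc-injective eq
∣dropFirst∣ (outside ∷ S) eq = ∣dropFirst∣ S eq

-- The first element of `S` precedes all of `e`, so putting it back makes it the element that
-- `dropFirst` removes. Since small indices are late vertices, a pair in `dropFirst S` thus becomes
-- the deciding pair of a triple in `S`.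
restoreFirst : ∀ (S : Subset n) {k} → ∣ S ∣ ≡ suc k → ∀ {e} → e ⊆ dropFirst S →
               ∃[ e⁺ ] (e⁺ ⊆ S × ∣ e⁺ ∣ ≡ suc ∣ e ∣ × dropFirst e⁺ ≡ e)
restoreFirst (b       ∷ S) eq {inside  ∷ e} e⊆ with b | e⊆ here
... | inside  | ()
... | outside | ()
restoreFirst (inside  ∷ S) eq {outside ∷ e} e⊆ =
  inside ∷ e , in⊆in (drop-∷-⊆ e⊆) , refl , refl
restoreFirst (outside ∷ S) eq {outside ∷ e} e⊆
  with e⁺ , e⁺⊆ , size , drop ← restoreFirst S eq (drop-∷-⊆ e⊆)
  = outside ∷ e⁺ , out⊆ e⁺⊆ , size , cong (outside ∷_) drop

singletons : ∀ n → List (Subset n)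
singletons zero    = []
singletons (suc n) = (inside ∷ ⊥) ∷ map (outside ∷_) (singletons n)

length-singletons : ∀ n → length (singletons n) ≡ n
length-singletons zero    = refl
length-singletons (suc n) = cong suc (trans (length-map _ (singletons n)) (length-singletons n))

∣S∣≡0⇒S≡⊥ : (S : Subset n) → ∣ S ∣ ≡ 0 → S ≡ ⊥
∣S∣≡0⇒S≡⊥ []            _  = refl
∣S∣≡0⇒S≡⊥ (outside ∷ S) eq = cong (outside ∷_) (∣S∣≡0⇒S≡⊥ S eq)

∈-singletons : (S : Subset n) → ∣ S ∣ ≡ 1 → S ∈ singletons n
∈-singletons (inside  ∷ S) eq = here (cong (inside ∷_) (∣S∣≡0⇒S≡⊥ S (suc-injective eq)))
∈-singletons (outside ∷ S) eq = there (∈-map⁺ _ (∈-singletons S eq))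

_ConstantOn_ : {A : Set} → (A → Bool) → List A → Set
T ConstantOn xs = ∀ {x y} → x ∈ xs → y ∈ xs → T x ≡ T y

module _ {A : Set} where
  fibre : (A → Bool) → List A → Bool → List A
  fibre T xs b = filter (λ x → T x Bool.≟ b) xs

  length-split : ∀ (T : A → Bool) xs →
    length xs ≡ length (fibre T xs true) + length (fibre T xs false)
  length-split T [] = refl
  length-split T (x ∷ xs) with T x
  ... | true  = cong suc (length-split T xs)
  ... | false = trans (cong suc (length-split T xs)) (sym (+-suc _ _))

  m+m≡2*m : ∀ m → m + m ≡ 2 * m
  m+m≡2*m m = cong (m +_) (sym (+-identityʳ m))

  majority : ∀ (T : A → Bool) xs → ∃[ b ] length xs ≤ 2 * length (fibre T xs b)
  majority T xs with ≤-total (length (fibre T xs false)) (length (fibre T xs true))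
  ... | inj₁ f≤t = true , ≤-trans (≤-reflexive (length-split T xs))
    (≤-trans (+-monoʳ-≤ _ f≤t) (≤-reflexive (m+m≡2*m (length (fibre T xs true)))))
  ... | inj₂ t≤f = false , ≤-trans (≤-reflexive (length-split T xs))
    (≤-trans (+-monoˡ-≤ _ t≤f) (≤-reflexive (m+m≡2*m (length (fibre T xs false)))))

  -- Each test keeps its majority value at the cost of a factor 2, and constancy survives all later
  -- filtering.
  homogenise : ∀ (Ts : List (A → Bool)) {xs} → Unique xs →
    ∃[ ys ] (Unique ys × ys ⊆ₗ xs × All (_ConstantOn ys) Ts × length xs ≤ 2 ^ length Ts * length ys)
  homogenise [] {xs} u = xs , u , id , [] , ≤-reflexive (sym (*-identityˡ (length xs)))
  homogenise (T ∷ Ts) {xs} u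
    with b , half ← majority T xs
    with ys , u′ , ys⊆ , const , len ← homogenise Ts (Unique.filter⁺ (λ x → T x Bool.≟ b) u)
    = ys , u′ , proj₁ ∘ inT , (λ x∈ y∈ → trans (proj₂ (inT x∈)) (sym (proj₂ (inT y∈)))) ∷ const , (begin
      length xs                        ≤⟨ half ⟩
      2 * length (fibre T xs b)        ≤⟨ *-monoʳ-≤ 2 len ⟩
      2 * (2 ^ length Ts * length ys)  ≡⟨ *-assoc 2 (2 ^ length Ts) (length ys) ⟨
      2 ^ suc (length Ts) * length ys  ∎)
    where
    open ≤-Reasoning
    inT : ∀ {x} → x ∈ ys → x ∈ xs × T x ≡ b
    inT = ∈-filter⁻ (λ x → T x Bool.≟ b) ∘ ys⊆

cons-injective : ∀ {a : Fin n} {P : Fin i → Fin n} → (∀ j → P j ≢ a) → Injective P → Injective (a F.∷ P)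
cons-injective fresh inj {zero}  {zero}  eq = refl
cons-injective fresh inj {zero}  {suc j} eq = contradiction (sym eq) (fresh j)
cons-injective fresh inj {suc i} {zero}  eq = contradiction eq (fresh i)
cons-injective fresh inj {suc i} {suc j} eq = cong suc (inj eq)

-- Greedy choice of a canonical vertex sequence.

module _ (G : Hypergraph 3 n) where

  -- Index 0 is the vertex chosen last: whether a triple is an edge is decided
  -- by its two vertices chosen first.
  Canonical : (Fin (suc m) → Fin n) → Set
  Canonical v = ∀ e → ∣ e ∣ ≡ 3 →
    edge? G (image v (outside ∷ e)) ≡ edge? G (image v (inside ∷ dropFirst e))

  -- The vertices P are chosen, and A lists the candidates for the next ones.
  record Stage (P : Fin i → Fin n) (A : List (Fin n)) : Set where
    field
      injective   : Injective P
      fresh       : ∀ {w} → w ∈ A → ∀ j → P j ≢ w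
      unique      : Unique A
      homogeneous : ∀ e → ∣ e ∣ ≡ 2 → (λ w → edge? G (⁅ w ⁆ ∪ image P e)) ConstantOn A
      canonical   : ∀ {w} → w ∈ A → Canonical (w F.∷ P)

  -- A new vertex forms `i` pairs with those already chosen, and agreement of the candidates on each
  -- costs a factor 2. The final 1 is the vertex that becomes index 0.
  needed : ℕ → ℕ → ℕ
  needed i zero    = 1
  needed i (suc j) = suc (2 ^ i * needed (suc i) j)

  -- The candidates already agree on pairs inside `P`; only the pairs of `a` with one vertex of `P`,
  -- indexed by `singletons i`, call for new halvings.
  extend : ∀ {P : Fin i → Fin n} {a A} → Stage P (a ∷ A) → ∀ {N} → 2 ^ i * N ≤ length A →
           ∃[ A′ ] (Stage (a F.∷ P) A′ × N ≤ length A′)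
  extend {i} {P} {a} {A} stage@record { unique = a∉A ∷ unique } {N} le
    with A′ , unique′ , A′⊆A , const , len ← homogenise
           (map (λ e w → edge? G (⁅ w ⁆ ∪ (⁅ a ⁆ ∪ image P e))) (singletons i)) unique
    = A′ , stage′ , *-cancelˡ-≤ (2 ^ i) {{m^n≢0 2 i}} (≤-trans le
        (subst (λ l → length A ≤ 2 ^ l * length A′) (trans (length-map _ (singletons i)) (length-singletons i)) len))
    where
    module O = Stage stage

    stage′ : Stage (a F.∷ P) A′
    stage′ .Stage.injective = cons-injective (O.fresh (here refl)) O.injective
    stage′ .Stage.fresh w∈ zero    = All.lookup a∉A (A′⊆A w∈)
    stage′ .Stage.fresh w∈ (suc j) = O.fresh (there (A′⊆A w∈)) j
    stage′ .Stage.unique = unique′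
    stage′ .Stage.homogeneous (outside ∷ e) ∣e∣ x∈ y∈ =
      O.homogeneous e ∣e∣ (there (A′⊆A x∈)) (there (A′⊆A y∈))
    stage′ .Stage.homogeneous (inside ∷ e) ∣e∣ =
      All.lookup (All.map⁻ const) (∈-singletons e (suc-injective ∣e∣))
    stage′ .Stage.canonical w∈ (outside ∷ e) ∣e∣ = O.canonical (there (A′⊆A w∈)) e ∣e∣
    -- Here `a` is the latest vertex of the triple. Both `a` and `w` were candidates before, so they
    -- agree on the pair `e`.
    stage′ .Stage.canonical w∈ (inside ∷ e) ∣e∣ =
      O.homogeneous e (suc-injective ∣e∣) (here refl) (there (A′⊆A w∈))

  grow : ∀ j {P : Fin i → Fin n} {A} → Stage P A → needed i j ≤ length A → j + i ≡ m →
         ∃[ v ] (Injective {suc m} v × Canonical v)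
  grow zero {P} {w ∷ A} stage _ refl =
    w F.∷ P , cons-injective (fresh (here refl)) injective , canonical (here refl)
    where open Stage stage
  grow {i} (suc j) {A = a ∷ A} stage (s≤s le) refl
    with A′ , stage′ , le′ ← extend stage le = grow j stage′ le′ (+-suc j i)

  1≤needed : ∀ i j → 1 ≤ needed i j
  1≤needed i zero    = ≤-refl
  1≤needed i (suc j) = s≤s z≤n

  -- Absorbing each `suc` by a doubling leaves factors 2^(i+1), ..., 2^(i+j); each is replaced by
  -- the largest. At `i = 0` this is 2^(j^2).
  needed≤ : ∀ i j → needed i j ≤ 2 ^ (j * (i + j))
  needed≤ i zero    = ≤-refl
  needed≤ i (suc j) = begin
    1 + 2 ^ i * needed (suc i) j                   ≤⟨ +-monoˡ-≤ _ (*-mono-≤ (m^n>0 2 i) (1≤needed (suc i) j)) ⟩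
    x + x                                          ≡⟨ cong (x +_) (+-identityʳ x) ⟨
    2 * (2 ^ i * needed (suc i) j)                 ≡⟨ *-assoc 2 (2 ^ i) _ ⟨
    2 ^ suc i * needed (suc i) j                   ≤⟨ *-mono-≤ (^-monoʳ-≤ 2 (m≤m+n (suc i) j)) (needed≤ (suc i) j) ⟩
    2 ^ (suc i + j) * 2 ^ (j * (suc i + j))        ≡⟨ ^-distribˡ-+-* 2 (suc i + j) (j * (suc i + j)) ⟨
    2 ^ (suc j * (suc i + j))                      ≡⟨ cong (λ z → 2 ^ (suc j * z)) (+-suc i j) ⟨
    2 ^ (suc j * (i + suc j))                      ∎
    where
    open ≤-Reasoning
    x = 2 ^ i * needed (suc i) j

  canonicalVertices : 2 ^ (m ^ 2) ≤ n → ∃[ v ] (Injective {suc m} v × Canonical v)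
  canonicalVertices {m} le = grow m {P = λ ()} {A = allFin n} start
    (≤-trans (needed≤ 0 m) (≤-trans (≤-reflexive (cong (λ z → 2 ^ (m * z)) (sym (*-identityʳ m))))
      (≤-trans le (≤-reflexive (sym (length-tabulate {n = n} id))))))
    (+-identityʳ m)
    where
    start : Stage (λ ()) (allFin n)
    start .Stage.injective {()}
    start .Stage.fresh _ ()
    start .Stage.unique = Unique.allFin⁺ n
    start .Stage.homogeneous [] ()
    start .Stage.canonical _ [] ()

  -- The link graph of the last vertex.

  module _ {v : Fin (suc m) → Fin n} (inj : Injective v) (canonical : Canonical v) where

    link : Hypergraph 2 m
    link .edge? e = edge? G (image v (inside ∷ e))
    link .uniform e edge = suc-injective (trans (sym (∣image∣ inj (inside ∷ e))) (uniform G _ edge))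

    -- Adding `v zero` to a clique of the link gives a clique of `G`: a triple avoiding `v zero`
    -- keeps its status when its latest vertex is replaced by `v zero`, and then it is a pair of the
    -- link clique.
    link-free : ∀ {t} → ¬ G Contains-K suc t → ¬ link Contains-K t
    link-free G-free (S , _ , ∣S∣≡t , complete) = G-free
      (image v (inside ∷ S) , ⊆⊤ , trans (∣image∣ inj (inside ∷ S)) (cong suc ∣S∣≡t) , edges)
      where
      edges : Complete G (image v (inside ∷ S))
      edges e e⊆ ∣e∣≡3 with ⊆-image⁻ inj {S = inside ∷ S} e⊆
      ... | inside ∷ e′ , e′⊆ , refl =
        complete e′ (drop-∷-⊆ e′⊆) (suc-injective (trans (sym (∣image∣ inj (inside ∷ e′))) ∣e∣≡3))
      ... | outside ∷ e′ , e′⊆ , refl = subst T (sym (canonical e′ ∣e′∣≡3))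
        (complete (dropFirst e′) (drop-∷-⊆ e′⊆ ∘ dropFirst⊆ e′) (∣dropFirst∣ e′ ∣e′∣≡3))
        where ∣e′∣≡3 = trans (sym (∣image∣ inj (outside ∷ e′))) ∣e∣≡3

    -- The latest vertex of the clique is sacrificed: every pair of the others is the deciding pair
    -- of its triple with that vertex, hence an edge of the link.
    clique-link : ∀ {W s} → G [ image v (outside ∷ W) ]Contains-K suc s → link [ W ]Contains-K s
    clique-link {W} {s} (_ , S⊆ , ∣S∣≡1+s , complete) with ⊆-image⁻ inj {S = outside ∷ W} S⊆
    ... | inside ∷ S , S⊆ , refl = contradiction (S⊆ here) λ ()
    ... | outside ∷ S , S⊆W , refl =
      dropFirst S , drop-∷-⊆ S⊆W ∘ dropFirst⊆ S , ∣dropFirst∣ S ∣S∣ , edges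
      where
      ∣S∣ : ∣ S ∣ ≡ suc s
      ∣S∣ = trans (sym (∣image∣ inj (outside ∷ S))) ∣S∣≡1+s

      edges : Complete link (dropFirst S)
      edges e e⊆ ∣e∣≡2 with e⁺ , e⁺⊆S , ∣e⁺∣ , refl ← restoreFirst S ∣S∣ e⊆ =
        subst T (canonical e⁺ ∣e⁺∣≡3)
          (complete _ (image-mono v {outside ∷ e⁺} {outside ∷ S} (out⊆ e⁺⊆S))
            (trans (∣image∣ inj (outside ∷ e⁺)) ∣e⁺∣≡3))
        where ∣e⁺∣≡3 = trans ∣e⁺∣ (cong suc ∣e∣≡2)

    α-link : ∀ {s} → 1 ≤ s → α s link ≤ α (suc s) G
    α-link {s} 1≤s with W , free , ∣W∣≡α ← α-attained 1≤s link =
      subst (_≤ α (suc s) G) (trans (∣image∣ inj (outside ∷ W)) ∣W∣≡α)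
        (α-upper (suc s) G (image v (outside ∷ W)) (free ∘ clique-link {W}))

stepping-down : ∀ {s t m n} → 3 ≤ suc s → suc s < suc t → 2 ^ (m ^ 2) ≤ n → f 2 s t m ≤ f 3 (suc s) (suc t) n
stepping-down {s} {t} {m} {n} 3≤s s<t le =
  let G , free , α≡f       = f-attained 3≤s s<t n
      v , inj , canonical  = canonicalVertices G {m} le
      1≤s                  = ≤-trans (s≤s z≤n) (s≤s⁻¹ 3≤s)
  in ≤-trans (f-lower 1≤s (link G inj canonical) (link-free G inj canonical free))
       (≤-trans (α-link G inj canonical 1≤s) (≤-reflexive α≡f))

-- The arithmetic of the union bound.

binomial≤ : ∀ u k → u ^ suc k + suc k * u ^ k ≤ suc u ^ suc k
binomial≤ u zero    = ≤-reflexive (+-comm (u * 1) 1)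
binomial≤ u (suc k) = begin
  u * p + (p + k′ * p)            ≡⟨ cong (u * p +_) (+-comm p (k′ * p)) ⟩
  u * p + (k′ * p + p)            ≡⟨ +-assoc (u * p) (k′ * p) p ⟨
  u * p + k′ * p + p              ≤⟨ +-monoʳ-≤ _ (m≤m+n p (k′ * u ^ k)) ⟩
  u * p + k′ * p + (p + k′ * u ^ k)  ≡⟨ cong (λ z → u * p + z + (p + k′ * u ^ k))
                                          (x∙yz≈y∙xz *-commutativeSemigroup k′ u (u ^ k)) ⟩
  u * p + u * (k′ * u ^ k) + (p + k′ * u ^ k)  ≡⟨ cong (_+ (p + k′ * u ^ k)) (*-distribˡ-+ u p _) ⟨
  u * (p + k′ * u ^ k) + (p + k′ * u ^ k)   ≡⟨ +-comm (u * (p + k′ * u ^ k)) _ ⟩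
  suc u * (p + k′ * u ^ k)        ≤⟨ *-monoʳ-≤ (suc u) (binomial≤ u k) ⟩
  suc u ^ suc (suc k)             ∎
  where
  open ≤-Reasoning
  p = u ^ suc k
  k′ = suc k

-- (1 − 1/Q)^Q ≤ 1/2 for Q = u + 1.
2*u^Q≤Q^Q : ∀ u → 2 * u ^ suc u ≤ suc u ^ suc u
2*u^Q≤Q^Q u = begin
  2 * u ^ suc u                ≡⟨ cong (u ^ suc u +_) (+-identityʳ _) ⟩
  u ^ suc u + u * u ^ u        ≤⟨ +-monoʳ-≤ (u ^ suc u) (m≤n+m (u * u ^ u) (u ^ u)) ⟩
  u ^ suc u + suc u * u ^ u    ≤⟨ binomial≤ u u ⟩
  suc u ^ suc u                ∎
  where open ≤-Reasoning

^-swap : ∀ a b c → (a ^ b) ^ c ≡ (a ^ c) ^ b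
^-swap a b c = trans (^-*-assoc a b c) (trans (cong (a ^_) (*-comm b c)) (sym (^-*-assoc a c b)))

-- Both sides are `R`-th powers, so bases are compared. As (1 - 1/Q)^Q ≤ 1/2, taking R = Qz gives (1
-- - 1/Q)^R ≤ 2^(-z), and z = s^2 ℓ is chosen to beat n^(s^2).
union-bound : ∀ Q .{{_ : NonZero Q}} s .{{_ : NonZero s}} {n ℓ} .{{_ : NonZero ℓ}} → n < 2 ^ ℓ →
  let R = Q * (s * s * ℓ) in
  n ^ (s * (s * R)) * (Q ∸ 1) ^ (R * R) < Q ^ (R * R)
union-bound (suc u) s {n} {ℓ} n<2^ℓ = begin-strict
  n ^ (s * (s * R)) * u ^ (R * R)     ≡⟨ cong₂ _*_ (trans (cong (n ^_) (sym (*-assoc s s R))) (sym (^-*-assoc n (s * s) R)))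
                                                   (sym (^-*-assoc u R R)) ⟩
  (n ^ (s * s)) ^ R * (u ^ R) ^ R     ≡⟨ ^-distribʳ-* R (n ^ (s * s)) (u ^ R) ⟨
  (n ^ (s * s) * u ^ R) ^ R           <⟨ ^-monoˡ-< R base ⟩
  (suc u ^ R) ^ R                     ≡⟨ ^-*-assoc (suc u) R R ⟩
  suc u ^ (R * R)                     ∎
  where
  open ≤-Reasoning
  z = s * s * ℓ
  R = suc u * z

  instance
    ss≢0 : NonZero (s * s)
    ss≢0 = m*n≢0 s s
    z≢0 : NonZero z
    z≢0 = m*n≢0 (s * s) ℓ
    R≢0 : NonZero R
    R≢0 = m*n≢0 (suc u) z

  ^-distribʳ-* : ∀ k a b → (a * b) ^ k ≡ a ^ k * b ^ k
  ^-distribʳ-* zero    a b = refl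
  ^-distribʳ-* (suc k) a b = trans (cong (a * b *_) (^-distribʳ-* k a b))
    (interchange *-commutativeSemigroup a b (a ^ k) (b ^ k))

  2^z*u^R≤Q^R : 2 ^ z * u ^ R ≤ suc u ^ R
  2^z*u^R≤Q^R = begin
    2 ^ z * u ^ R               ≡⟨ cong (2 ^ z *_) (^-*-assoc u (suc u) z) ⟨
    2 ^ z * (u ^ suc u) ^ z     ≡⟨ ^-distribʳ-* z 2 (u ^ suc u) ⟨
    (2 * u ^ suc u) ^ z         ≤⟨ ^-monoˡ-≤ z (2*u^Q≤Q^Q u) ⟩
    (suc u ^ suc u) ^ z         ≡⟨ ^-*-assoc (suc u) (suc u) z ⟩
    suc u ^ R                   ∎

  n^ss<2^z : n ^ (s * s) < 2 ^ z
  n^ss<2^z = begin-strict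
    n ^ (s * s)          <⟨ ^-monoˡ-< (s * s) n<2^ℓ ⟩
    (2 ^ ℓ) ^ (s * s)    ≡⟨ ^-swap 2 ℓ (s * s) ⟩
    (2 ^ (s * s)) ^ ℓ    ≡⟨ ^-*-assoc 2 (s * s) ℓ ⟩
    2 ^ z                ∎

  base : n ^ (s * s) * u ^ R < suc u ^ R
  base with u ^ R in eq
  -- For `Q = 1` the factor `u ^ R` vanishes and cannot carry a strict inequality.
  ... | zero  = subst (_< suc u ^ R) (sym (*-zeroʳ (n ^ (s * s)))) (m^n>0 (suc u) R)
  ... | suc p = <-≤-trans (*-monoˡ-< (suc p) n^ss<2^z) (subst (λ p → 2 ^ z * p ≤ suc u ^ R) eq 2^z*u^R≤Q^R)

-- From powers of 2 to the constant `C`.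

⌊log₂⌋-exists : ∀ {n} → 2 ≤ n → ∃[ k ] (1 ≤ k × 2 ^ k ≤ n × n < 2 ^ suc k)
⌊log₂⌋-exists {suc zero} (s≤s ())
⌊log₂⌋-exists {suc (suc zero)} _ = 1 , ≤-refl , ≤-refl , s≤s (s≤s (s≤s z≤n))
⌊log₂⌋-exists {suc n@(suc (suc _))} _
  with k , 1≤k , 2^k≤n , n<2^1+k ← ⌊log₂⌋-exists {n} (s≤s (s≤s z≤n))
  with m≤n⇒m<n∨m≡n n<2^1+k
... | inj₁ lt = k , 1≤k , m≤n⇒m≤1+n 2^k≤n , lt
... | inj₂ eq = suc k , s≤s z≤n , ≤-reflexive (sym eq) ,
                subst (λ p → suc n < 2 * p) eq (m<m+n (suc n) z<s)

module _ (q : ℕ) .{{q≢0 : NonZero q}} where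
  private
    s = suc q
    Q = q ^ D q

    instance
      Q≢0 : NonZero Q
      Q≢0 = m^n≢0 q (D q)

  -- The grid has `s * s * r` points with `r = Q * (s * s * ℓ)`; this is its size per unit of `ℓ`, a
  -- function of `q` alone.
  upperFactor : ℕ
  upperFactor = s * (s * (Q * (s * s)))

  upperFactor≢0 : NonZero upperFactor
  upperFactor≢0 = m*n≢0 s (s * (Q * (s * s))) {{_}} {{m*n≢0 s (Q * (s * s)) {{_}} {{m*n≢0 Q (s * s)}}}}

  f<upperFactor*ℓ : ∀ {t n ℓ} .{{_ : NonZero ℓ}} → s < t → n < 2 ^ ℓ → f 3 s t n < upperFactor * ℓ
  f<upperFactor*ℓ {t} {n} {ℓ} s<t n<2^ℓ = subst (f 3 s t n <_) size≡
    (Lines.f-upper q (Q * (s * s * ℓ)) n (union-bound Q s n<2^ℓ) s<t)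
    where
    size≡ : Lines.size q (Q * (s * s * ℓ)) n ≡ upperFactor * ℓ
    size≡ = begin
      s * (s * (Q * (s * s * ℓ)))   ≡⟨ cong (λ z → s * (s * z)) (*-assoc Q (s * s) ℓ) ⟨
      s * (s * (Q * (s * s) * ℓ))   ≡⟨ cong (s *_) (*-assoc s (Q * (s * s)) ℓ) ⟨
      s * (s * (Q * (s * s)) * ℓ)   ≡⟨ *-assoc s (s * (Q * (s * s))) ℓ ⟨
      upperFactor * ℓ               ∎
      where open ≡-Reasoning

-- One factor 2 raises `k + 1` to `2 k`, which is where `1 ≤ k` enters; the other converts `k` into
-- log n by `log-lower`.
≤K*[1+k]⇒≤4K·log : ∀ K k {y n x} → y ≤ K * suc k → 1 ≤ k → 2 ^ k ≤ n → log n < x →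
                   fromℕ y ℚ.≤ fromℕ (4 * K) ℚ.* x
≤K*[1+k]⇒≤4K·log K k {y} {n} {x} y≤ 1≤k 2^k≤n log<x = begin
  fromℕ y                              ≤⟨ fromℕ-mono-≤ (≤-trans y≤ (*-monoʳ-≤ K 1+k≤2k)) ⟩
  fromℕ (K * (2 * k))                  ≡⟨ cong fromℕ (x∙yz≈yx∙z *-commutativeSemigroup K 2 k) ⟩
  fromℕ (2 * K * k)                    ≡⟨ fromℕ-* (2 * K) k ⟩
  fromℕ (2 * K) ℚ.* fromℕ k            ≤⟨ ℚ.*-monoˡ-≤-nonNeg (fromℕ (2 * K)) {{fromℕ-nonNeg (2 * K)}}
                                            (log-lower {k} 2^k≤n log<x) ⟩
  fromℕ (2 * K) ℚ.* (fromℕ 2 ℚ.* x)    ≡⟨ ℚ.*-assoc (fromℕ (2 * K)) (fromℕ 2) x ⟨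
  fromℕ (2 * K) ℚ.* fromℕ 2 ℚ.* x      ≡⟨ cong (ℚ._* x) (fromℕ-* (2 * K) 2) ⟨
  fromℕ (2 * K * 2) ℚ.* x              ≡⟨ cong (λ z → fromℕ z ℚ.* x) (trans (*-comm (2 * K) 2) (sym (*-assoc 2 2 K))) ⟩
  fromℕ (4 * K) ℚ.* x                  ∎
  where
  open ℚ.≤-Reasoning

  1+k≤2k : suc k ≤ 2 * k
  1+k≤2k = subst (_≤ 2 * k) (+-comm k 1) (+-monoʳ-≤ k (≤-trans 1≤k (m≤m+n k 0)))

theorem1 : ∀ (s : ℕ) → 3 ≤ s →
    ∃[ C ] (0ℚ ℚ.< C ×
    (∀ (t : ℕ) → s < t → ∀ (n : ℕ) → 2 ≤ n →
    (∀ (m : ℕ) → m ≡⌊√log n ⌋ → f 2 (s ∸ 1) (t ∸ 1) m ≤ f 3 s t n)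
    × (fromℕ (f 3 s t n) ≤ C ·log n)))
theorem1 (suc q) 3≤s = fromℕ (4 * K) , C>0 , bounds
  where
  instance
    q≢0 : NonZero q
    q≢0 = >-nonZero (≤-trans z<s (s≤s⁻¹ 3≤s))

  K = upperFactor q

  C>0 : 0ℚ ℚ.< fromℕ (4 * K)
  C>0 = ℚ.<-≤-trans (ℚ.positive⁻¹ ℚ.1ℚ)
    (fromℕ-mono-≤ {1} {4 * K} (>-nonZero⁻¹ (4 * K) {{m*n≢0 4 K {{_}} {{upperFactor≢0 q}}}}))

  bounds : ∀ t → suc q < t → ∀ n → 2 ≤ n →
    (∀ m → m ≡⌊√log n ⌋ → f 2 q (t ∸ 1) m ≤ f 3 (suc q) t n)
    × (fromℕ (f 3 (suc q) t n) ≤ fromℕ (4 * K) ·log n)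
  bounds (suc t) s<t n 2≤n =
    -- The power above `n` serves the union bound; the power below it turns `k` back into log n.
    let k , 1≤k , 2^k≤n , n<2^1+k = ⌊log₂⌋-exists 2≤n
    in (λ m (m²≤log , _) → stepping-down {q} {t} {m} {n} 3≤s s<t (2^≤ {m ^ 2} (<⇒≤ 2≤n) m²≤log))
     , (λ x → ≤K*[1+k]⇒≤4K·log K k (<⇒≤ (f<upperFactor*ℓ q s<t n<2^1+k)) 1≤k 2^k≤n)
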